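{- For every $f\ge0$, $$\begin{aligned}F_{2,f}(t)={}&(6f+3)\,t(1+t)^{f+2}+\left(24f+60\binom f2\right)t^2(1+t)^f\\&+\left(48\binom f2+192\binom f3\right)t^3(1+t)^{f-2}+192\binom f4\,t^4(1+t)^{f-4}.\end{aligned}$$
   Context: Terms whose coefficient vanishes are $0$ (so negative powers of $1+t$ never actually occur). For $n\ge1$, $\mathfrak B_n$ is the hyperoctahedral group of signed permutations: words $\pi=\pi_1\cdots\pi_n$ of nonzero integers such that $|\pi_1|,\dots,|\pi_n|$ is a permutation of $[n]=\{1,\dots,n\}$, with $\pi(i)=\pi_i$, $\pi(-i)=-\pi(i)$. $\mathcal I_n^B$ is the set of $\pi\in\mathfrak B_n$ with $\pi^2=\mathrm{id}$. With $\pi_0=0$ and the usual order on $\mathbb Z$, $\operatorname{des}^B(\pi)=\#\{0\le i\le n-1:\pi_i>\pi_{i+1}\}$. $\operatorname{fix}_B(\pi)=\#\{i\in[n]:|\pi(i)|=i\}$, and $\operatorname{cyc}_2(\pi)$ is the number of two-cycles of the ordinary involution $i\mapsto|\pi(i)|$ of $[n]$. The polynomial $F_{2,f}$ is the case $j=2$ of $$F_{j,f}(t)=\sum_{\substack{\pi\in\mathcal I_{2j+f}^B\\ \operatorname{cyc}_2(\pi)=j,\ \operatorname{fix}_B(\pi)=f}}t^{\operatorname{des}^B(\pi)}.$$ -}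

module Defs where

open import Data.Empty using (⊥)
open import Data.Integer using (ℤ; +_; -[1+_]; -_; ∣_∣)
open import Data.Integer.Properties using (+-injective; neg-injective)
import Data.Integer as ℤ
import Data.Integer.Properties as ℤₚ
open import Data.List using (List; []; _∷_; _++_; map; filter; foldr; length; upTo; cartesianProduct; cartesianProductWith)
open import Data.List.Membership.DecPropositional using (_∈?_)
open import Data.List.Membership.Propositional using (_∈_)
open import Data.List.Membership.Propositional.Properties using (∈-∃++; ∈-map⁺; ∈-map⁻; ∈-++⁺ˡ; ∈-++⁺ʳ; ∈-filter⁺; ∈-cartesianProductWith⁺)
open import Data.List.Relation.Binary.Permutation.Propositional using (_↭_; ↭-refl; ↭-sym; ↭-trans; prep)
open import Data.List.Relation.Binary.Permutation.Propositional.Properties using (¬x∷xs↭[]; ∈-resp-↭; drop-mid; shift)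
open import Data.List.Relation.Unary.All using (All; all?)
open import Data.List.Relation.Unary.Any using (here; there)
open import Data.List.Relation.Unary.Unique.Propositional using (Unique; []; _∷_)
import Data.List.Relation.Unary.Unique.Propositional.Properties as Uniqueₚ
import Data.List.Relation.Unary.All as All
open import Data.Nat using (ℕ; zero; suc; _+_; _*_; _<_; _<?_; _≟_)
open import Data.Nat.Properties using (suc-injective)
open import Data.Product using (_×_; _,_; ∃)
open import Data.Vec using (Vec; []; _∷_; toList)
open import Data.Vec.Properties using (∷-injective)
open import Relation.Binary.PropositionalEquality using (_≡_; refl)
open import Relation.Nullary using (Dec; yes; no; _×-dec_)
open import Relation.Unary using (Pred; Decidable)
open import Level using (0ℓ)

-- Polynomials in t over ℕ, as coefficient lists with the constant term first.
-- Trailing zeros are allowed, so equality is _≈_ below and not _≡_.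

Poly : Set
Poly = List ℕ

coeff : Poly → ℕ → ℕ
coeff []      _       = 0
coeff (a ∷ p) zero    = a
coeff (a ∷ p) (suc k) = coeff p k

infix 4 _≈_
_≈_ : Poly → Poly → Set
p ≈ q = ∀ k → coeff p k ≡ coeff q k

infixl 6 _⊕_
_⊕_ : Poly → Poly → Poly
[]      ⊕ q       = q
(a ∷ p) ⊕ []      = a ∷ p
(a ∷ p) ⊕ (b ∷ q) = (a + b) ∷ (p ⊕ q)

infixr 7 _·_
_·_ : ℕ → Poly → Poly
c · p = map (c *_) p

infixl 7 _⊗_
_⊗_ : Poly → Poly → Poly
[]      ⊗ q = []
(a ∷ p) ⊗ q = (a · q) ⊕ (0 ∷ (p ⊗ q))

infixr 8 _^ᵖ_
_^ᵖ_ : Poly → ℕ → Poly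
p ^ᵖ zero  = 1 ∷ []
p ^ᵖ suc n = p ⊗ (p ^ᵖ n)

t : Poly
t = 0 ∷ 1 ∷ []

1+t : Poly
1+t = (1 ∷ []) ⊕ t

Σᵖ : List Poly → Poly
Σᵖ = foldr _⊕_ []

count : {A : Set} {P : Pred A 0ℓ} → Decidable P → List A → ℕ
count P? xs = length (filter P? xs)

[1⋯_] : ℕ → List ℕ
[1⋯ n ] = map suc (upTo n)

±[1⋯_] : ℕ → List ℤ
±[1⋯ n ] = map +_ [1⋯ n ] ++ map (λ i → - (+ i)) [1⋯ n ]

Word : ℕ → Set
Word n = Vec ℤ n

-- The i-th letter, counted from 0.  Positions beyond the end of the word get
-- the junk value 0.
letter : ∀ {n} → Word n → ℕ → ℤ
letter []      _       = + 0
letter (x ∷ π) zero    = x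
letter (x ∷ π) (suc i) = letter π i

-- The map i ↦ π(i) with π(i) = πᵢ for i ∈ [n], π(0) = 0 and π(-i) = -π(i).
infix 9 _⟨_⟩
_⟨_⟩ : ∀ {n} → Word n → ℤ → ℤ
π ⟨ + zero   ⟩ = + 0
π ⟨ + suc i  ⟩ = letter π i
π ⟨ -[1+ i ] ⟩ = - letter π i

-- The letters are automatically nonzero, because 0 is not in [1⋯ n ].
IsSignedPermutation : ∀ {n} → Word n → Set
IsSignedPermutation {n} π = map ∣_∣ (toList π) ↭ [1⋯ n ]

IsInvolution : ∀ {n} → Word n → Set
IsInvolution {n} π = All (λ i → π ⟨ π ⟨ i ⟩ ⟩ ≡ i) ±[1⋯ n ]

_↭?_ : (xs ys : List ℕ) → Dec (xs ↭ ys)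
[]       ↭? []       = yes ↭-refl
[]       ↭? (y ∷ ys) = no λ p → ¬x∷xs↭[] (↭-sym p)
(x ∷ xs) ↭? ys with _∈?_ _≟_ x ys
... | no x∉ys = no λ p → x∉ys (∈-resp-↭ p (here refl))
... | yes x∈ys with ∈-∃++ x∈ys
...   | as , bs , refl with xs ↭? (as ++ bs)
...     | yes p = yes (↭-trans (prep x p) (↭-sym (shift x as bs)))
...     | no ¬p = no λ p → ¬p (drop-mid [] as p)

isSignedPermutation? : ∀ {n} → Decidable (IsSignedPermutation {n})
isSignedPermutation? {n} π = map ∣_∣ (toList π) ↭? [1⋯ n ]

isInvolution? : ∀ {n} → Decidable (IsInvolution {n})
isInvolution? {n} π = all? (λ i → π ⟨ π ⟨ i ⟩ ⟩ ℤ.≟ i) ±[1⋯ n ]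

wordsOver : List ℤ → (n : ℕ) → List (Word n)
wordsOver A zero    = [] ∷ []
wordsOver A (suc n) = cartesianProductWith _∷_ A (wordsOver A n)

-- The group 𝔅ₙ, listed without repetition (see 𝔅-complete and 𝔅-unique).
𝔅 : (n : ℕ) → List (Word n)
𝔅 n = filter isSignedPermutation? (wordsOver ±[1⋯ n ] n)

ℐᴮ : (n : ℕ) → List (Word n)
ℐᴮ n = filter isInvolution? (𝔅 n)

desᴮ : ∀ {n} → Word n → ℕ
desᴮ {n} π = count (λ i → π ⟨ + suc i ⟩ ℤₚ.<? π ⟨ + i ⟩) (upTo n)

fixᴮ : ∀ {n} → Word n → ℕ
fixᴮ {n} π = count (λ i → ∣ π ⟨ + i ⟩ ∣ ≟ i) [1⋯ n ]

-- Each two-cycle is counted once, as the pair (i , j) with i < j.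
IsTwoCycle : ∀ {n} → Word n → Pred (ℕ × ℕ) 0ℓ
IsTwoCycle π (i , j) = i < j × ∣ π ⟨ + i ⟩ ∣ ≡ j × ∣ π ⟨ + j ⟩ ∣ ≡ i

isTwoCycle? : ∀ {n} (π : Word n) → Decidable (IsTwoCycle π)
isTwoCycle? π (i , j) =
  (i <? j) ×-dec (∣ π ⟨ + i ⟩ ∣ ≟ j) ×-dec (∣ π ⟨ + j ⟩ ∣ ≟ i)

cyc₂ : ∀ {n} → Word n → ℕ
cyc₂ {n} π = count (isTwoCycle? π) (cartesianProduct [1⋯ n ] [1⋯ n ])

F : ℕ → ℕ → Poly
F j f = Σᵖ (map (λ π → t ^ᵖ desᴮ π)
  (filter (λ π → (cyc₂ π ≟ j) ×-dec (fixᴮ π ≟ f)) (ℐᴮ (2 * j + f))))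

∣i∣∈⇒i∈± : ∀ {n} i → ∣ i ∣ ∈ [1⋯ n ] → i ∈ ±[1⋯ n ]
∣i∣∈⇒i∈± (+ i)    p = ∈-++⁺ˡ (∈-map⁺ +_ p)
∣i∣∈⇒i∈± -[1+ i ] p = ∈-++⁺ʳ _ (∈-map⁺ (λ i → - (+ i)) p)

∈-wordsOver : ∀ {A n} (π : Word n) → (∀ {x} → x ∈ toList π → x ∈ A) → π ∈ wordsOver A n
∈-wordsOver []      _ = here refl
∈-wordsOver (x ∷ π) h =
  ∈-cartesianProductWith⁺ _∷_ (h (here refl)) (∈-wordsOver π (λ p → h (there p)))

wordsOver-unique : ∀ {A} n → Unique A → Unique (wordsOver A n)
wordsOver-unique zero    _ = All.[] ∷ []
wordsOver-unique (suc n) u =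
  Uniqueₚ.cartesianProductWith⁺ _∷_ ∷-injective u (wordsOver-unique n u)

[1⋯]-unique : ∀ n → Unique [1⋯ n ]
[1⋯]-unique n = Uniqueₚ.map⁺ suc-injective (Uniqueₚ.upTo⁺ n)

±[1⋯]-unique : ∀ n → Unique ±[1⋯ n ]
±[1⋯]-unique n = Uniqueₚ.++⁺
  (Uniqueₚ.map⁺ +-injective ([1⋯]-unique n))
  (Uniqueₚ.map⁺ (λ e → +-injective (neg-injective e)) ([1⋯]-unique n))
  λ { (p , q) → disjoint (∈-map⁻ +_ p) (∈-map⁻ (λ i → - (+ i)) q) }
  where
  disjoint : ∀ {v} → ∃ (λ i → i ∈ [1⋯ n ] × v ≡ + i) → ∃ (λ i → i ∈ [1⋯ n ] × v ≡ - (+ i)) → ⊥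
  disjoint (_ , _ , refl) (_ , q , e) with ∈-map⁻ suc q
  disjoint (_ , _ , refl) (_ , q , ()) | _ , _ , refl

𝔅-complete : ∀ {n} {π : Word n} → IsSignedPermutation π → π ∈ 𝔅 n
𝔅-complete {n} {π} p = ∈-filter⁺ isSignedPermutation?
  (∈-wordsOver π λ {x} x∈π → ∣i∣∈⇒i∈± x (∈-resp-↭ p (∈-map⁺ ∣_∣ x∈π))) p

𝔅-unique : ∀ n → Unique (𝔅 n)
𝔅-unique n = Uniqueₚ.filter⁺ isSignedPermutation? (wordsOver-unique n (±[1⋯]-unique n))

-- Deleting the fixed letters of π and standardising leaves a signed involution c of
-- [2j] without fixed points, and π is recovered from c and the pattern of fixed and
-- moved letters. Of two adjacent letters, the one that is larger in absolute value
-- decides by its sign whether they form a descent, so desᴮ π depends only on c, the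
-- pattern and the signs of the fixed points. Summing over these for a given c, each
-- block of fixed points between two consecutive letters of c contributes one factor to
-- the generating function in the number f of fixed points. This factor is a polynomial
-- in J = x/(1 - (1+t)x), where x marks f, up to a factor K = 1/(1 - (1+t)x). For j = 2
-- the sum over the 12 words c is found by evaluation, and J^i K has the coefficients
-- (f C i) (1+t)^(f-i).
module Submission where

open import Defs
open import Algebra using (CommutativeSemiring)
open import Data.Bool using (Bool; true; false; if_then_else_)
open import Data.Empty using (⊥; ⊥-elim)
open import Data.Integer using (ℤ; +_; -[1+_]; -_; ∣_∣; _◃_; sign; +<+; -<-)
import Data.Integer.Properties as ℤₚ
open import Data.List using (List; []; _∷_; _++_; map; foldr; filter; length; upTo; cartesianProduct; cartesianProductWith)
open import Data.List.Membership.Propositional using (_∈_)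
open import Data.List.Membership.Propositional.Properties
open import Data.List.Membership.Propositional.Properties.WithK using (unique∧set⇒bag)
import Data.List.Properties as Listₚ
open import Data.List.Relation.Binary.BagAndSetEquality using (∼bag⇒↭)
open import Data.List.Relation.Binary.Permutation.Propositional as ↭ using (_↭_)
open import Data.List.Relation.Binary.Permutation.Propositional.Properties using (∈-resp-↭; ↭-length)
open import Data.List.Relation.Unary.All as All using (All; []; _∷_; all?)
import Data.List.Relation.Unary.All.Properties as Allₚ
open import Data.List.Relation.Unary.Any using (here; there)
open import Data.List.Relation.Unary.Unique.Propositional using (Unique; []; _∷_)
import Data.List.Relation.Unary.Unique.Propositional.Properties as Uniqueₚ
open import Data.Nat using (ℕ; zero; suc; _+_; _*_; _∸_; _≤_; _<_; _≤ᵇ_; s≤s; z≤n; _≟_; _≤?_)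
open import Data.Nat.Combinatorics using (_C_; nC1≡n; nCk+nC[k+1]≡[n+1]C[k+1])
open import Data.Nat.Combinatorics.Specification using (k>n⇒nCk≡0)
import Data.Nat.Properties as ℕₚ
open import Data.Product using (_,_; _×_; proj₁; proj₂; ∃; ∃₂)
open import Data.Sign as Sign using (Sign)
open import Data.Sum using (_⊎_; inj₁; inj₂)
open import Data.Unit using (⊤)
open import Data.Vec using ([]; _∷_; toList)
import Data.Vec as Vec
import Data.Vec.Properties as Vecₚ
open import Function using (_∘_; mk⇔)
open import Level using (0ℓ)
open import Relation.Binary.Definitions using (tri<; tri≈; tri>)
open import Relation.Binary.PropositionalEquality using (_≡_; _≢_; refl; sym; trans; cong; cong₂; subst; subst₂; module ≡-Reasoning)
import Relation.Binary.Reasoning.Setoid as SetoidReasoning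
open import Relation.Nullary using (yes; no; does; ofʸ; ofⁿ; ¬?; _×-dec_)
open import Relation.Nullary.Decidable using (dec-true; dec-false; from-yes)
open import Relation.Unary using (Pred; Decidable)

-- The semiring of polynomials

-- Call a moved letter small or large for a block of fixed points according to whether its absolute
-- value is at most the number of moved letters before the block. No letter of `c` is fixed, so a
-- letter has the same status for the block before it and the block after it. A block from a small
-- to a large letter contributes a factor `K`; a block from a large to a small letter becomes a
-- polynomial in `J` only together with a factor `K`. The word starts at π₀ = 0, which is small, and
-- its last moved letter is small as well, with a final block that contributes one more `K`. The
-- passages in the two directions therefore pair off, exactly one `K` survives, and what multiplies
-- it is a polynomial in `J` that does not depend on f. This turns the statement for all f into one
-- finite evaluation. The 12 words come from the three perfect matchings of [4], with a sign for
-- each of the two cycles.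

coeff-⊕ : ∀ p q k → coeff (p ⊕ q) k ≡ coeff p k + coeff q k
coeff-⊕ []      q       k       = refl
coeff-⊕ (a ∷ p) []      k       = sym (ℕₚ.+-identityʳ _)
coeff-⊕ (a ∷ p) (b ∷ q) zero    = refl
coeff-⊕ (a ∷ p) (b ∷ q) (suc k) = coeff-⊕ p q k

coeff-· : ∀ c p k → coeff (c · p) k ≡ c * coeff p k
coeff-· c []      k       = sym (ℕₚ.*-zeroʳ c)
coeff-· c (a ∷ p) zero    = refl
coeff-· c (a ∷ p) (suc k) = coeff-· c p k

-- _≈_ unfolds to a function type, from which Agda cannot infer the two polynomials.
infix 4 _≋_
record _≋_ (p q : Poly) : Set where
  constructor mk≋
  field coeffs : p ≈ q

open _≋_

≋-refl : ∀ {p} → p ≋ p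
≋-refl = mk≋ λ k → refl

≋-reflexive : ∀ {p q} → p ≡ q → p ≋ q
≋-reflexive refl = ≋-refl

≋-sym : ∀ {p q} → p ≋ q → q ≋ p
≋-sym (mk≋ e) = mk≋ λ k → sym (e k)

≋-trans : ∀ {p q r} → p ≋ q → q ≋ r → p ≋ r
≋-trans (mk≋ e) (mk≋ e′) = mk≋ λ k → trans (e k) (e′ k)

⊕-cong : ∀ {p p′ q q′} → p ≋ p′ → q ≋ q′ → p ⊕ q ≋ p′ ⊕ q′
⊕-cong {p} {p′} {q} {q′} e e′ .coeffs k =
  trans (coeff-⊕ p q k) (trans (cong₂ _+_ (e .coeffs k) (e′ .coeffs k)) (sym (coeff-⊕ p′ q′ k)))

⊕-congˡ : ∀ p {q q′} → q ≋ q′ → p ⊕ q ≋ p ⊕ q′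
⊕-congˡ p = ⊕-cong (≋-refl {p})

⊕-congʳ : ∀ q {p p′} → p ≋ p′ → p ⊕ q ≋ p′ ⊕ q
⊕-congʳ q e = ⊕-cong e (≋-refl {q})

⊕-assoc : ∀ p q r → (p ⊕ q) ⊕ r ≋ p ⊕ (q ⊕ r)
⊕-assoc p q r .coeffs k rewrite coeff-⊕ (p ⊕ q) r k | coeff-⊕ p q k
  | coeff-⊕ p (q ⊕ r) k | coeff-⊕ q r k = ℕₚ.+-assoc (coeff p k) _ _

⊕-comm : ∀ p q → p ⊕ q ≋ q ⊕ p
⊕-comm p q .coeffs k rewrite coeff-⊕ p q k | coeff-⊕ q p k = ℕₚ.+-comm (coeff p k) _

⊕-identityʳ : ∀ p → p ⊕ [] ≋ p
⊕-identityʳ p .coeffs k = trans (coeff-⊕ p [] k) (ℕₚ.+-identityʳ _)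

⊕-interchange : ∀ p q r s → (p ⊕ q) ⊕ (r ⊕ s) ≋ (p ⊕ r) ⊕ (q ⊕ s)
⊕-interchange p q r s = mk≋ interchange-at
  where
  open import Algebra.Properties.CommutativeSemigroup ℕₚ.+-commutativeSemigroup using (interchange)
  interchange-at : (p ⊕ q) ⊕ (r ⊕ s) ≈ (p ⊕ r) ⊕ (q ⊕ s)
  interchange-at k
    rewrite coeff-⊕ (p ⊕ q) (r ⊕ s) k | coeff-⊕ p q k | coeff-⊕ r s k
          | coeff-⊕ (p ⊕ r) (q ⊕ s) k | coeff-⊕ p r k | coeff-⊕ q s k
    = interchange (coeff p k) (coeff q k) (coeff r k) (coeff s k)

∷-cong : ∀ {a b p q} → a ≡ b → p ≋ q → (a ∷ p) ≋ (b ∷ q)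
∷-cong e e′ .coeffs zero    = e
∷-cong e e′ .coeffs (suc k) = e′ .coeffs k

0∷[] : (0 ∷ []) ≋ []
0∷[] .coeffs zero    = refl
0∷[] .coeffs (suc k) = refl

·-cong : ∀ {a b p q} → a ≡ b → p ≋ q → a · p ≋ b · q
·-cong {a} {b} {p} {q} e e′ .coeffs k =
  trans (coeff-· a p k) (trans (cong₂ _*_ e (e′ .coeffs k)) (sym (coeff-· b q k)))

·-distribˡ : ∀ a p q → a · (p ⊕ q) ≋ a · p ⊕ a · q
·-distribˡ a p q .coeffs k rewrite coeff-· a (p ⊕ q) k | coeff-⊕ p q k
  | coeff-⊕ (a · p) (a · q) k | coeff-· a p k | coeff-· a q k = ℕₚ.*-distribˡ-+ a _ _

·-assoc : ∀ a b p → (a * b) · p ≋ a · b · p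
·-assoc a b p .coeffs k rewrite coeff-· (a * b) p k | coeff-· a (b · p) k | coeff-· b p k =
  ℕₚ.*-assoc a b _

·-zero : ∀ p → 0 · p ≋ []
·-zero p .coeffs k = coeff-· 0 p k

·-identity : ∀ p → 1 · p ≋ p
·-identity p .coeffs k = trans (coeff-· 1 p k) (ℕₚ.+-identityʳ _)

⊗-congˡ : ∀ p {q q′} → q ≋ q′ → p ⊗ q ≋ p ⊗ q′
⊗-congˡ []      e = ≋-refl
⊗-congˡ (a ∷ p) e = ⊕-cong (·-cong {a} refl e) (∷-cong refl (⊗-congˡ p e))

⊗-zeroʳ : ∀ p → p ⊗ [] ≋ []
⊗-zeroʳ []      = ≋-refl
⊗-zeroʳ (a ∷ p) = ≋-trans (∷-cong refl (⊗-zeroʳ p)) 0∷[]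

-- `_⊗_` recurses on its left factor; this is the mirrored recursion, on which commutativity rests.
⊗-∷ : ∀ p b q → p ⊗ (b ∷ q) ≋ b · p ⊕ (0 ∷ p ⊗ q)
⊗-∷ []      b q = ≋-sym 0∷[]
⊗-∷ (a ∷ p) b q = ∷-cong (cong (_+ 0) (ℕₚ.*-comm a b))
  (≋-trans (⊕-cong ≋-refl (⊗-∷ p b q))
  (≋-trans (≋-sym (⊕-assoc (a · q) (b · p) _))
  (≋-trans (⊕-cong (⊕-comm (a · q) (b · p)) ≋-refl)
           (⊕-assoc (b · p) (a · q) _))))

⊗-comm : ∀ p q → p ⊗ q ≋ q ⊗ p
⊗-comm []      q = ≋-sym (⊗-zeroʳ q)
⊗-comm (a ∷ p) q = ≋-trans (⊕-cong ≋-refl (∷-cong refl (⊗-comm p q))) (≋-sym (⊗-∷ q a p))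

-- Equal polynomials can be lists of different lengths, which obstructs a direct induction on the
-- left factor. Commutativity moves that factor to the right, where congruence is already known.
⊗-cong : ∀ {p p′ q q′} → p ≋ p′ → q ≋ q′ → p ⊗ q ≋ p′ ⊗ q′
⊗-cong {p} {p′} {q} {q′} e e′ = ≋-trans (⊗-congˡ p e′)
  (≋-trans (⊗-comm p q′) (≋-trans (⊗-congˡ q′ e) (⊗-comm q′ p′)))

⊗-distribˡ : ∀ p q r → p ⊗ (q ⊕ r) ≋ p ⊗ q ⊕ p ⊗ r
⊗-distribˡ []      q r = ≋-refl
⊗-distribˡ (a ∷ p) q r =
  ≋-trans (⊕-cong (·-distribˡ a q r) (∷-cong refl (⊗-distribˡ p q r)))
          (⊕-interchange (a · q) (a · r) (0 ∷ p ⊗ q) (0 ∷ p ⊗ r))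

⊗-distribʳ : ∀ p q r → (q ⊕ r) ⊗ p ≋ q ⊗ p ⊕ r ⊗ p
⊗-distribʳ p q r = ≋-trans (⊗-comm (q ⊕ r) p)
  (≋-trans (⊗-distribˡ p q r) (⊕-cong (⊗-comm p q) (⊗-comm p r)))

·-⊗ : ∀ a p q → (a · p) ⊗ q ≋ a · (p ⊗ q)
·-⊗ a []      q = ≋-refl
·-⊗ a (b ∷ p) q =
  ≋-trans (⊕-cong (·-assoc a b q) (∷-cong (sym (ℕₚ.*-zeroʳ a)) (·-⊗ a p q)))
          (≋-sym (·-distribˡ a (b · q) (0 ∷ p ⊗ q)))

⊗-assoc : ∀ p q r → (p ⊗ q) ⊗ r ≋ p ⊗ (q ⊗ r)
⊗-assoc []      q r = ≋-refl
⊗-assoc (a ∷ p) q r = ≋-trans (⊗-distribʳ r (a · q) (0 ∷ p ⊗ q))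
  (⊕-cong (·-⊗ a q r) (⊕-cong (·-zero r) (∷-cong refl (⊗-assoc p q r))))

∷[]-⊗ : ∀ a p → (a ∷ []) ⊗ p ≋ a · p
∷[]-⊗ a p = ≋-trans (⊕-cong (≋-refl {a · p}) 0∷[]) (⊕-identityʳ (a · p))

⊗-identityˡ : ∀ p → (1 ∷ []) ⊗ p ≋ p
⊗-identityˡ p = ≋-trans (∷[]-⊗ 1 p) (·-identity p)

Poly-commutativeSemiring : CommutativeSemiring 0ℓ 0ℓ
Poly-commutativeSemiring = record
  { Carrier = Poly ; _≈_ = _≋_ ; _+_ = _⊕_ ; _*_ = _⊗_ ; 0# = [] ; 1# = 1 ∷ []
  ; isCommutativeSemiring = record
    { isSemiring = record
      { isSemiringWithoutAnnihilatingZero = record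
        { +-isCommutativeMonoid = record
          { isMonoid = record
            { isSemigroup = record
              { isMagma = record
                { isEquivalence = record { refl = ≋-refl ; sym = ≋-sym ; trans = ≋-trans }
                ; ∙-cong = ⊕-cong }
              ; assoc = ⊕-assoc }
            ; identity = (λ p → ≋-refl) , ⊕-identityʳ }
          ; comm = ⊕-comm }
        ; *-cong = ⊗-cong
        ; *-assoc = ⊗-assoc
        ; *-identity = ⊗-identityˡ , λ p → ≋-trans (⊗-comm p (1 ∷ [])) (⊗-identityˡ p)
        ; distrib = ⊗-distribˡ , ⊗-distribʳ }
      ; zero = (λ p → ≋-refl) , ⊗-zeroʳ }
    ; *-comm = ⊗-comm } }

import Algebra.Solver.Ring.NaturalCoefficients.Default Poly-commutativeSemiring as Solver
open Solver using (solve; con; _:+_; _:*_; _:=_)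
module ≋-Reasoning = SetoidReasoning (CommutativeSemiring.setoid Poly-commutativeSemiring)

-- Generating functions of the completions of a word

-- On generating functions in x, which marks the fixed points, K is multiplication
-- by 1/(1 - (1+t)x) and J is multiplication by x/(1 - (1+t)x).
J : (ℕ → Poly) → ℕ → Poly
J g zero    = []
J g (suc f) = g f ⊕ 1+t ⊗ J g f

K : (ℕ → Poly) → ℕ → Poly
K g f = g f ⊕ 1+t ⊗ J g f

J-cong : ∀ {g h} → (∀ f → g f ≋ h f) → ∀ f → J g f ≋ J h f
J-cong e zero    = ≋-refl
J-cong e (suc f) = ⊕-cong (e f) (⊗-congˡ 1+t (J-cong e f))

J-⊕ : ∀ g h f → J (λ f → g f ⊕ h f) f ≋ J g f ⊕ J h f
J-⊕ g h zero    = ≋-refl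
J-⊕ g h (suc f) = ≋-trans (⊕-congˡ (g f ⊕ h f) (⊗-congˡ 1+t (J-⊕ g h f)))
  (solve 5 (λ u a b c d → (a :+ b) :+ u :* (c :+ d) := (a :+ u :* c) :+ (b :+ u :* d))
    ≋-refl 1+t (g f) (h f) (J g f) (J h f))

J-⊗ : ∀ a g f → J (λ f → a ⊗ g f) f ≋ a ⊗ J g f
J-⊗ a g zero    = ≋-sym (⊗-zeroʳ a)
J-⊗ a g (suc f) = ≋-trans (⊕-congˡ (a ⊗ g f) (⊗-congˡ 1+t (J-⊗ a g f)))
  (solve 4 (λ u a b c → a :* b :+ u :* (a :* c) := a :* (b :+ u :* c))
    ≋-refl 1+t a (g f) (J g f))

K-cong : ∀ {g h} → (∀ f → g f ≋ h f) → ∀ f → K g f ≋ K h f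
K-cong e f = ⊕-cong (e f) (⊗-congˡ 1+t (J-cong e f))

K-⊕ : ∀ g h f → K (λ f → g f ⊕ h f) f ≋ K g f ⊕ K h f
-- `K g f` and `J g (suc f)` have the same unfolding.
K-⊕ g h f = J-⊕ g h (suc f)

K-⊗ : ∀ a g f → K (λ f → a ⊗ g f) f ≋ a ⊗ K g f
K-⊗ a g f = J-⊗ a g (suc f)

-- `K` is 1 + (1+t) `J`, so it commutes with the linear operator `J`. This is what brings `K` to the
-- outside.
JK : ∀ g f → J (K g) f ≋ K (J g) f
JK g f = ≋-trans (J-⊕ g (λ f → 1+t ⊗ J g f) f) (⊕-congˡ (J g f) (J-⊗ 1+t (J g) f))

-- The polynomial a₀ + a₁ J + a₂ J² + ⋯ in J, applied to the sequence 1, 0, 0, ….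
⟦_⟧ : List Poly → ℕ → Poly
⟦ []    ⟧ f       = []
⟦ a ∷ q ⟧ zero    = a
⟦ a ∷ q ⟧ (suc f) = J ⟦ q ⟧ (suc f)

infixl 6 _⊞_
_⊞_ : List Poly → List Poly → List Poly
[]      ⊞ r       = r
(a ∷ q) ⊞ []      = a ∷ q
(a ∷ q) ⊞ (b ∷ r) = (a ⊕ b) ∷ (q ⊞ r)

infixr 7 _⊡_
_⊡_ : Poly → List Poly → List Poly
a ⊡ q = map (a ⊗_) q

𝕁 : List Poly → List Poly
𝕁 q = [] ∷ q

⟦⟧-⊞ : ∀ q r f → ⟦ q ⊞ r ⟧ f ≋ ⟦ q ⟧ f ⊕ ⟦ r ⟧ f
⟦⟧-⊞ []      r       f       = ≋-refl
⟦⟧-⊞ (a ∷ q) []      f       = ≋-sym (⊕-identityʳ _)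
⟦⟧-⊞ (a ∷ q) (b ∷ r) zero    = ≋-refl
⟦⟧-⊞ (a ∷ q) (b ∷ r) (suc f) = ≋-trans (J-cong (⟦⟧-⊞ q r) (suc f)) (J-⊕ ⟦ q ⟧ ⟦ r ⟧ (suc f))

⟦⟧-⊡ : ∀ a q f → ⟦ a ⊡ q ⟧ f ≋ a ⊗ ⟦ q ⟧ f
⟦⟧-⊡ a []      f       = ≋-sym (⊗-zeroʳ a)
⟦⟧-⊡ a (b ∷ q) zero    = ≋-refl
⟦⟧-⊡ a (b ∷ q) (suc f) = ≋-trans (J-cong (⟦⟧-⊡ a q) (suc f)) (J-⊗ a ⟦ q ⟧ (suc f))

⟦⟧-𝕁 : ∀ q f → ⟦ 𝕁 q ⟧ f ≋ J ⟦ q ⟧ f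
⟦⟧-𝕁 q zero    = ≋-refl
⟦⟧-𝕁 q (suc f) = ≋-refl

⟦⟧-𝕁-double : ∀ q f → ⟦ 𝕁 (q ⊞ q) ⟧ f ≋ J ⟦ q ⟧ f ⊕ J ⟦ q ⟧ f
⟦⟧-𝕁-double q f = ≋-trans (⟦⟧-𝕁 (q ⊞ q) f)
  (≋-trans (J-cong (⟦⟧-⊞ q q) f) (J-⊕ ⟦ q ⟧ ⟦ q ⟧ f))

⟦⟧-small-small : ∀ a b q f →
  ⟦ a ⊡ 𝕁 (q ⊞ q) ⊞ b ⊡ q ⟧ f ≋ a ⊗ (J ⟦ q ⟧ f ⊕ J ⟦ q ⟧ f) ⊕ b ⊗ ⟦ q ⟧ f
⟦⟧-small-small a b q f = ≋-trans (⟦⟧-⊞ (a ⊡ 𝕁 (q ⊞ q)) (b ⊡ q) f)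
  (⊕-cong (≋-trans (⟦⟧-⊡ a (𝕁 (q ⊞ q)) f) (⊗-congˡ a (⟦⟧-𝕁-double q f))) (⟦⟧-⊡ b q f))

⟦⟧-big-small : ∀ a b c q f →
  ⟦ a ⊡ (q ⊞ b ⊡ 𝕁 (q ⊞ q) ⊞ c ⊡ 𝕁 (𝕁 (q ⊞ q ⊞ q ⊞ q))) ⟧ f ≋
  a ⊗ (⟦ q ⟧ f ⊕ b ⊗ (J ⟦ q ⟧ f ⊕ J ⟦ q ⟧ f) ⊕
       c ⊗ (J (J ⟦ q ⟧) f ⊕ J (J ⟦ q ⟧) f ⊕ J (J ⟦ q ⟧) f ⊕ J (J ⟦ q ⟧) f))
⟦⟧-big-small a b c q f = ≋-trans (⟦⟧-⊡ a (q ⊞ b ⊡ q₁ ⊞ c ⊡ q₂) f) (⊗-congˡ a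
  (≋-trans (⟦⟧-⊞ (q ⊞ b ⊡ q₁) (c ⊡ q₂) f) (⊕-cong
    (≋-trans (⟦⟧-⊞ q (b ⊡ q₁) f) (⊕-congˡ (g f)
      (≋-trans (⟦⟧-⊡ b q₁ f) (⊗-congˡ b (⟦⟧-𝕁-double q f)))))
    (≋-trans (⟦⟧-⊡ c q₂ f) (⊗-congˡ c
      (≋-trans (⟦⟧-𝕁 (𝕁 (q ⊞ q ⊞ q ⊞ q)) f)
      (≋-trans (J-cong (λ f → ≋-trans (⟦⟧-𝕁 (q ⊞ q ⊞ q ⊞ q) f) (quadruple f)) f)
               (J-four j f))))))))
  where
  q₁ q₂ : List Poly
  q₁ = 𝕁 (q ⊞ q)
  q₂ = 𝕁 (𝕁 (q ⊞ q ⊞ q ⊞ q))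
  g j : ℕ → Poly
  g = ⟦ q ⟧
  j = J g
  J-four : ∀ h f → J (λ f → h f ⊕ h f ⊕ h f ⊕ h f) f ≋ J h f ⊕ J h f ⊕ J h f ⊕ J h f
  J-four h f = ≋-trans (J-⊕ (λ f → h f ⊕ h f ⊕ h f) h f) (⊕-congʳ (J h f)
    (≋-trans (J-⊕ (λ f → h f ⊕ h f) h f) (⊕-congʳ (J h f) (J-⊕ h h f))))
  quadruple : ∀ f → J ⟦ q ⊞ q ⊞ q ⊞ q ⟧ f ≋ j f ⊕ j f ⊕ j f ⊕ j f
  quadruple f = ≋-trans (J-cong (λ f → ≋-trans (⟦⟧-⊞ (q ⊞ q ⊞ q) q f) (⊕-congʳ (g f)
    (≋-trans (⟦⟧-⊞ (q ⊞ q) q f) (⊕-congʳ (g f) (⟦⟧-⊞ q q f))))) f) (J-four g f)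

-- Transfer through blocks of fixed points

isNegative isPositive : ℤ → Bool
isNegative (+ _)     = false
isNegative -[1+ _ ]  = true
isPositive (+ zero)  = false
isPositive (+ suc _) = true
isPositive -[1+ _ ]  = false

-- The letter moved c has the sign of c, and its absolute value is the position of
-- the ∣c∣-th moved letter; moved 0 is the letter π₀ = 0.
data Label : Set where
  fixed : Sign → Label
  moved : ℤ → Label

-- k is the number of moved letters that precede the fixed letters in question.
isDescent : ℕ → Label → Label → Bool
isDescent k (fixed _) (fixed σ)       = isNegative (σ ◃ 1)
isDescent k (fixed σ) (moved c)       = if ∣ c ∣ ≤ᵇ k then isPositive (σ ◃ 1) else isNegative c
isDescent k (moved z) (fixed σ)       = if ∣ z ∣ ≤ᵇ k then isNegative (σ ◃ 1) else isPositive z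
isDescent k (moved z) (moved c)       = if ∣ z ∣ ≤ᵇ ∣ c ∣ then isNegative c else isPositive z

t? : Bool → Poly
t? b = if b then t else 1 ∷ []

-- T ζ k cs f sums t^des over the ways to complete a word whose current letter is ζ
-- and which already has k moved letters, by the moved letters cs and f fixed points.
T : ∀ {m} → Label → ℕ → Word m → ℕ → Poly
T ζ k []       zero    = 1 ∷ []
T ζ k []       (suc f) =
  t? (isDescent k ζ (fixed Sign.+)) ⊗ T (fixed Sign.+) k [] f ⊕
  t? (isDescent k ζ (fixed Sign.-)) ⊗ T (fixed Sign.-) k [] f
T ζ k (c ∷ cs) zero    = t? (isDescent k ζ (moved c)) ⊗ T (moved c) (suc k) cs zero
T ζ k (c ∷ cs) (suc f) =
  t? (isDescent k ζ (fixed Sign.+)) ⊗ T (fixed Sign.+) k (c ∷ cs) f ⊕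
  t? (isDescent k ζ (fixed Sign.-)) ⊗ T (fixed Sign.-) k (c ∷ cs) f ⊕
  t? (isDescent k ζ (moved c)) ⊗ T (moved c) (suc k) cs (suc f)

-- A block of fixed points contributes a factor determined by whether its neighbours
-- z and c are smaller (∣z∣ ≤ k, ∣c∣ ≤ k) or larger in absolute value than the block.
-- If ∣z∣ ≤ k, the value is the series T (moved z) k divided by K: this is what makes
-- the factor between a larger z and a smaller c a polynomial in J.
T̂ : ∀ {m} → ℤ → ℕ → Word m → List Poly
T̂ z k []       = (1 ∷ []) ∷ []
T̂ z k (c ∷ cs) with T̂ c (suc k) cs | ∣ z ∣ ≤ᵇ k | ∣ c ∣ ≤ᵇ k
... | q | true  | true  = t ⊡ 𝕁 (q ⊞ q) ⊞ t? (isDescent k (moved z) (moved c)) ⊡ q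
... | q | true  | false = t? (isNegative c) ⊡ q
... | q | false | true  = t? (isPositive z) ⊡ (q ⊞ 1+t ⊡ 𝕁 (q ⊞ q) ⊞ t ⊡ 𝕁 (𝕁 (q ⊞ q ⊞ q ⊞ q)))
... | q | false | false =
  t? (isPositive z) ⊡ t? (isNegative c) ⊡ 𝕁 (q ⊞ q) ⊞ t? (isDescent k (moved z) (moved c)) ⊡ q

-- c is the letter in position k + 1 of a word with k + m + 1 letters.
Admissible : ∀ {m} → ℕ → Word m → Set
Admissible         k []       = ⊤
Admissible {suc m} k (c ∷ cs) = ∣ c ∣ ≢ suc k × ∣ c ∣ ≤ k + suc m × Admissible (suc k) cs

-- Satisfied by a small moved letter and, by computation, by every fixed letter. An induction along
-- a block can thus start at the moved letter and continue at the fixed ones.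
SmallLabel : ℕ → Label → Set
SmallLabel k ζ = ∀ σ → isDescent k ζ (fixed σ) ≡ isNegative (σ ◃ 1)

T-[] : ∀ ζ k → SmallLabel k ζ → ∀ f → T ζ k [] f ≋ K ⟦ (1 ∷ []) ∷ [] ⟧ f
T-[] ζ k ζ-small zero = solve 1 (λ u → con 1 := con 1 :+ u :* con 0) ≋-refl 1+t
T-[] ζ k ζ-small (suc f) rewrite ζ-small Sign.+ | ζ-small Sign.- = begin
  (1 ∷ []) ⊗ T (fixed Sign.+) k [] f ⊕ t ⊗ T (fixed Sign.-) k [] f
    ≈⟨ ⊕-cong (⊗-congˡ (1 ∷ []) (T-[] (fixed Sign.+) k (λ σ → refl) f))
              (⊗-congˡ t (T-[] (fixed Sign.-) k (λ σ → refl) f)) ⟩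
  (1 ∷ []) ⊗ e f ⊕ t ⊗ e f
    ≈⟨ solve 2 (λ t x → con 1 :* x :+ t :* x := con 0 :+ (con 1 :+ t) :* x) ≋-refl t (e f) ⟩
  [] ⊕ 1+t ⊗ e f
    ≈⟨ ⊕-congʳ (1+t ⊗ e f) (J-⟦[]⟧ (suc f)) ⟨
  e (suc f) ∎
  where
  open ≋-Reasoning
  e = K ⟦ (1 ∷ []) ∷ [] ⟧
  J-⟦[]⟧ : ∀ f → J ⟦ [] ⟧ f ≋ []
  J-⟦[]⟧ zero    = ≋-refl
  J-⟦[]⟧ (suc f) = ≋-trans (⊗-congˡ 1+t (J-⟦[]⟧ f)) (⊗-zeroʳ 1+t)

module _ {m} (c : ℤ) (k : ℕ) (cs : Word m) where

  private
    Q : ℕ → Poly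
    Q = T (moved c) (suc k) cs

  -- Each fixed point decides the border to its left. The last one also decides the border to `c`,
  -- with the opposite outcome, so it has exactly one descent and contributes t for either sign,
  -- while the earlier ones contribute `1+t` each. Nonempty blocks sum to 2t `J`; the other term is
  -- the empty block.
  T-small-small : ∀ ζ → SmallLabel k ζ → (∣ c ∣ ≤ᵇ k) ≡ true → ∀ f →
    T ζ k (c ∷ cs) f ≋ t ⊗ (J Q f ⊕ J Q f) ⊕ t? (isDescent k ζ (moved c)) ⊗ Q f
  T-small-small ζ ζ-small c-small zero =
    solve 2 (λ t x → x := t :* (con 0 :+ con 0) :+ x) ≋-refl t (t? (isDescent k ζ (moved c)) ⊗ Q zero)
  T-small-small ζ ζ-small c-small (suc f) rewrite ζ-small Sign.+ | ζ-small Sign.- = begin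
    (1 ∷ []) ⊗ T (fixed Sign.+) k (c ∷ cs) f ⊕ t ⊗ T (fixed Sign.-) k (c ∷ cs) f ⊕ r
      ≈⟨ ⊕-cong (⊕-cong (⊗-congˡ (1 ∷ []) (after-fixed Sign.+))
                        (⊗-congˡ t (after-fixed Sign.-))) ≋-refl ⟩
    (1 ∷ []) ⊗ (t ⊗ (j ⊕ j) ⊕ t ⊗ q) ⊕ t ⊗ (t ⊗ (j ⊕ j) ⊕ (1 ∷ []) ⊗ q) ⊕ r
      ≈⟨ solve 4 (λ t j q r →
           con 1 :* (t :* (j :+ j) :+ t :* q) :+ t :* (t :* (j :+ j) :+ con 1 :* q) :+ r :=
           t :* ((q :+ (con 1 :+ t) :* j) :+ (q :+ (con 1 :+ t) :* j)) :+ r) ≋-refl t j q r ⟩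
    t ⊗ (J Q (suc f) ⊕ J Q (suc f)) ⊕ r ∎
    where
    open ≋-Reasoning
    j = J Q f
    q = Q f
    r = t? (isDescent k ζ (moved c)) ⊗ Q (suc f)
    after-fixed : ∀ σ → T (fixed σ) k (c ∷ cs) f ≋ t ⊗ (j ⊕ j) ⊕ t? (isPositive (σ ◃ 1)) ⊗ q
    after-fixed σ = subst (λ b → T (fixed σ) k (c ∷ cs) f ≋ t ⊗ (j ⊕ j) ⊕ t? b ⊗ q)
      (cong (λ b → if b then isPositive (σ ◃ 1) else isNegative c) c-small)
      (T-small-small (fixed σ) (λ σ → refl) c-small f)

  -- The border before `c` is decided by `c`, so every fixed point, the last included, contributes
  -- `1+t`. The sum over all lengths from 0 is `K`.
  T-small-big : ∀ ζ → SmallLabel k ζ → (∣ c ∣ ≤ᵇ k) ≡ false →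
    isDescent k ζ (moved c) ≡ isNegative c → ∀ f →
    T ζ k (c ∷ cs) f ≋ t? (isNegative c) ⊗ K Q f
  T-small-big ζ ζ-small c-big ζc zero rewrite ζc =
    solve 3 (λ w q u → w :* q := w :* (q :+ u :* con 0)) ≋-refl (t? (isNegative c)) (Q zero) 1+t
  T-small-big ζ ζ-small c-big ζc (suc f) rewrite ζ-small Sign.+ | ζ-small Sign.- | ζc = begin
    (1 ∷ []) ⊗ T (fixed Sign.+) k (c ∷ cs) f ⊕ t ⊗ T (fixed Sign.-) k (c ∷ cs) f ⊕ w ⊗ q
      ≈⟨ ⊕-cong (⊕-cong (⊗-congˡ (1 ∷ []) (after-fixed Sign.+))
                        (⊗-congˡ t (after-fixed Sign.-))) ≋-refl ⟩
    (1 ∷ []) ⊗ (w ⊗ K Q f) ⊕ t ⊗ (w ⊗ K Q f) ⊕ w ⊗ q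
      ≈⟨ solve 4 (λ t w q x → con 1 :* (w :* x) :+ t :* (w :* x) :+ w :* q :=
           w :* (q :+ (con 1 :+ t) :* x)) ≋-refl t w q (K Q f) ⟩
    w ⊗ K Q (suc f) ∎
    where
    open ≋-Reasoning
    w = t? (isNegative c)
    q = Q (suc f)
    after-fixed : ∀ σ → T (fixed σ) k (c ∷ cs) f ≋ w ⊗ K Q f
    after-fixed σ = T-small-big (fixed σ) (λ σ → refl) c-big
      (cong (λ b → if b then isPositive (σ ◃ 1) else isNegative c) c-big) f

  -- The first border is decided by the letter on its left. Beyond that weight, blocks of length 0,
  -- 1 and at least 2 give 1, (1+t)x and 4t x² `K`: of two or more fixed points the first has a free
  -- sign, the last contributes 2t. Times the `K` in `Q` this is `K` + (1+t) `J` + 4t `J`², and `K`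
  -- = 1 + (1+t) `J` yields the stated polynomial.
  T-big-small : ∀ ζ s → (∀ σ → isDescent k ζ (fixed σ) ≡ s) → (∣ c ∣ ≤ᵇ k) ≡ true →
    isDescent k ζ (moved c) ≡ s → ∀ g → (∀ f → Q f ≋ K g f) → ∀ f →
    T ζ k (c ∷ cs) f ≋
      t? s ⊗ (g f ⊕ 1+t ⊗ (J g f ⊕ J g f) ⊕ t ⊗ (J (J g) f ⊕ J (J g) f ⊕ J (J g) f ⊕ J (J g) f))
  T-big-small ζ s ζσ c-small ζc g Q≋Kg zero rewrite ζc = ≋-trans (⊗-congˡ (t? s) (Q≋Kg zero))
    (solve 3 (λ w g t → w :* (g :+ (con 1 :+ t) :* con 0) :=
       w :* (g :+ (con 1 :+ t) :* (con 0 :+ con 0) :+ t :* (con 0 :+ con 0 :+ con 0 :+ con 0)))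
      ≋-refl (t? s) (g zero) t)
  T-big-small ζ s ζσ c-small ζc g Q≋Kg (suc f) rewrite ζσ Sign.+ | ζσ Sign.- | ζc = begin
    w ⊗ T (fixed Sign.+) k (c ∷ cs) f ⊕ w ⊗ T (fixed Sign.-) k (c ∷ cs) f ⊕ w ⊗ Q (suc f)
      ≈⟨ ⊕-cong (⊕-cong (⊗-congˡ w (after-fixed Sign.+)) (⊗-congˡ w (after-fixed Sign.-)))
                (⊗-congˡ w (Q≋Kg (suc f))) ⟩
    w ⊗ (t ⊗ (jk ⊕ jk) ⊕ t ⊗ K g f) ⊕ w ⊗ (t ⊗ (jk ⊕ jk) ⊕ (1 ∷ []) ⊗ K g f) ⊕ w ⊗ K g (suc f)
      ≈⟨ solve 5 (λ t w g x y →
           w :* (t :* (y :+ y) :+ t :* x) :+ w :* (t :* (y :+ y) :+ con 1 :* x) :+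
             w :* (g :+ (con 1 :+ t) :* x) :=
           w :* (g :+ (con 1 :+ t) :* (x :+ x) :+ t :* (y :+ y :+ y :+ y)))
         ≋-refl t w (g (suc f)) (K g f) jk ⟩
    w ⊗ (g (suc f) ⊕ 1+t ⊗ (K g f ⊕ K g f) ⊕ t ⊗ (jk ⊕ jk ⊕ jk ⊕ jk)) ∎
    where
    open ≋-Reasoning
    w = t? s
    jk = K (J g) f
    JQ≋jk : J Q f ≋ jk
    JQ≋jk = ≋-trans (J-cong Q≋Kg f) (JK g f)
    after-fixed : ∀ σ →
      T (fixed σ) k (c ∷ cs) f ≋ t ⊗ (jk ⊕ jk) ⊕ t? (isPositive (σ ◃ 1)) ⊗ K g f
    after-fixed σ = ≋-trans (T-small-small (fixed σ) (λ σ → refl) c-small f)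
      (subst (λ b → t ⊗ (J Q f ⊕ J Q f) ⊕ t? b ⊗ Q f ≋
                    t ⊗ (jk ⊕ jk) ⊕ t? (isPositive (σ ◃ 1)) ⊗ K g f)
        (sym (cong (λ b → if b then isPositive (σ ◃ 1) else isNegative c) c-small))
        (⊕-cong (⊗-congˡ t (⊕-cong JQ≋jk JQ≋jk)) (⊗-congˡ (t? (isPositive (σ ◃ 1))) (Q≋Kg f))))

  -- Both outer borders of a nonempty block are decided by the moved letters. The first fixed point
  -- has a free sign, the others contribute `1+t` each, which makes 2 `J`.
  T-big-big : ∀ ζ s → (∀ σ → isDescent k ζ (fixed σ) ≡ s) → (∣ c ∣ ≤ᵇ k) ≡ false → ∀ f →
    T ζ k (c ∷ cs) f ≋
      t? s ⊗ (t? (isNegative c) ⊗ (J Q f ⊕ J Q f)) ⊕ t? (isDescent k ζ (moved c)) ⊗ Q f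
  T-big-big ζ s ζσ c-big zero =
    solve 3 (λ v w x → x := v :* (w :* (con 0 :+ con 0)) :+ x) ≋-refl
      (t? s) (t? (isNegative c)) (t? (isDescent k ζ (moved c)) ⊗ Q zero)
  T-big-big ζ s ζσ c-big (suc f) rewrite ζσ Sign.+ | ζσ Sign.- = begin
    v ⊗ T (fixed Sign.+) k (c ∷ cs) f ⊕ v ⊗ T (fixed Sign.-) k (c ∷ cs) f ⊕ r
      ≈⟨ ⊕-congʳ r (⊕-cong (⊗-congˡ v (after-fixed Sign.+)) (⊗-congˡ v (after-fixed Sign.-))) ⟩
    v ⊗ (w ⊗ K Q f) ⊕ v ⊗ (w ⊗ K Q f) ⊕ r
      ≈⟨ solve 4 (λ v w x r → v :* (w :* x) :+ v :* (w :* x) :+ r := v :* (w :* (x :+ x)) :+ r)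
         ≋-refl v w (K Q f) r ⟩
    v ⊗ (w ⊗ (K Q f ⊕ K Q f)) ⊕ r ∎
    where
    open ≋-Reasoning
    v = t? s
    w = t? (isNegative c)
    r = t? (isDescent k ζ (moved c)) ⊗ Q (suc f)
    after-fixed : ∀ σ → T (fixed σ) k (c ∷ cs) f ≋ w ⊗ K Q f
    after-fixed σ = T-small-big (fixed σ) (λ σ → refl) c-big
      (cong (λ b → if b then isPositive (σ ◃ 1) else isNegative c) c-big) f

≤ᵇ-true : ∀ {m n} → m ≤ n → (m ≤ᵇ n) ≡ true
≤ᵇ-true {m} {n} m≤n with m ≤ᵇ n | ℕₚ.≤ᵇ-reflects-≤ m n
... | true  | _       = refl
... | false | ofⁿ m≰n = ⊥-elim (m≰n m≤n)

≤ᵇ-false : ∀ {m n} → n < m → (m ≤ᵇ n) ≡ false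
≤ᵇ-false {m} {n} n<m with m ≤ᵇ n | ℕₚ.≤ᵇ-reflects-≤ m n
... | true  | ofʸ m≤n = ⊥-elim (ℕₚ.<⇒≱ n<m m≤n)
... | false | _       = refl

-- Admissibility excludes `∣ c ∣ ≡ suc k`, so comparing `∣ c ∣` with `k` or with `suc k` gives the
-- same answer. Hence the induction hypothesis carries a `K` exactly when `c` is small for the
-- current block. At the end of the word the bound on `∣ z ∣` makes `z` small.
T≋T̂ : ∀ {m} z k (cs : Word m) → ∣ z ∣ ≤ k + m → Admissible k cs → ∀ f →
  T (moved z) k cs f ≋ (if ∣ z ∣ ≤ᵇ k then K ⟦ T̂ z k cs ⟧ f else ⟦ T̂ z k cs ⟧ f)
T≋T̂ z k [] z≤ _ f rewrite ≤ᵇ-true (subst (∣ z ∣ ≤_) (ℕₚ.+-identityʳ k) z≤) =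
  T-[] (moved z) k (λ σ → cong (λ b → if b then isNegative (σ ◃ 1) else isPositive z)
    (≤ᵇ-true (subst (∣ z ∣ ≤_) (ℕₚ.+-identityʳ k) z≤))) f
T≋T̂ {suc m} z k (c ∷ cs) z≤ (c≢ , c≤ , adm) f
  with T̂ c (suc k) cs | T≋T̂ c (suc k) cs (subst (∣ c ∣ ≤_) (ℕₚ.+-suc k m) c≤) adm
     | ∣ z ∣ ≤ᵇ k in z≤ᵇk | ℕₚ.≤ᵇ-reflects-≤ ∣ z ∣ k | ∣ c ∣ ≤ᵇ k in c≤ᵇk | ℕₚ.≤ᵇ-reflects-≤ ∣ c ∣ k
... | q | Q≋ | true | ofʸ z≤k | true | ofʸ c≤k = begin
  T (moved z) k (c ∷ cs) f
    ≈⟨ T-small-small c k cs (moved z) z-small c≤ᵇk f ⟩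
  t ⊗ (J Q f ⊕ J Q f) ⊕ w ⊗ Q f
    ≈⟨ ⊕-cong (⊗-congˡ t (⊕-cong JQ≋ JQ≋)) (⊗-congˡ w (Q≋Kg f)) ⟩
  t ⊗ (K (J g) f ⊕ K (J g) f) ⊕ w ⊗ K g f
    ≈⟨ ⊕-cong (⊗-congˡ t (K-⊕ (J g) (J g) f)) (K-⊗ w g f) ⟨
  t ⊗ K (λ f → J g f ⊕ J g f) f ⊕ K (λ f → w ⊗ g f) f
    ≈⟨ ⊕-congʳ _ (K-⊗ t (λ f → J g f ⊕ J g f) f) ⟨
  K (λ f → t ⊗ (J g f ⊕ J g f)) f ⊕ K (λ f → w ⊗ g f) f
    ≈⟨ K-⊕ (λ f → t ⊗ (J g f ⊕ J g f)) (λ f → w ⊗ g f) f ⟨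
  K (λ f → t ⊗ (J g f ⊕ J g f) ⊕ w ⊗ g f) f
    ≈⟨ K-cong (⟦⟧-small-small t w q) f ⟨
  K ⟦ t ⊡ 𝕁 (q ⊞ q) ⊞ w ⊡ q ⟧ f ∎
  where
  open ≋-Reasoning
  Q g : ℕ → Poly
  Q = T (moved c) (suc k) cs
  g = ⟦ q ⟧
  w = t? (isDescent k (moved z) (moved c))
  z-small : SmallLabel k (moved z)
  z-small σ = cong (λ b → if b then isNegative (σ ◃ 1) else isPositive z) z≤ᵇk
  Q≋Kg : ∀ f → Q f ≋ K g f
  Q≋Kg f = subst (λ b → Q f ≋ (if b then K g f else g f)) (≤ᵇ-true (ℕₚ.m≤n⇒m≤1+n c≤k)) (Q≋ f)
  JQ≋ : J Q f ≋ K (J g) f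
  JQ≋ = ≋-trans (J-cong Q≋Kg f) (JK g f)
... | q | Q≋ | true | ofʸ z≤k | false | ofⁿ c≰k = begin
  T (moved z) k (c ∷ cs) f
    ≈⟨ T-small-big c k cs (moved z) z-small c≤ᵇk zc f ⟩
  w ⊗ K Q f
    ≈⟨ ⊗-congˡ w (K-cong Q≋g f) ⟩
  w ⊗ K g f
    ≈⟨ K-⊗ w g f ⟨
  K (λ f → w ⊗ g f) f
    ≈⟨ K-cong (⟦⟧-⊡ w q) f ⟨
  K ⟦ w ⊡ q ⟧ f ∎
  where
  open ≋-Reasoning
  Q g : ℕ → Poly
  Q = T (moved c) (suc k) cs
  g = ⟦ q ⟧
  w = t? (isNegative c)
  z-small : SmallLabel k (moved z)
  z-small σ = cong (λ b → if b then isNegative (σ ◃ 1) else isPositive z) z≤ᵇk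
  zc : isDescent k (moved z) (moved c) ≡ isNegative c
  zc = cong (λ b → if b then isNegative c else isPositive z)
    (≤ᵇ-true (ℕₚ.≤-trans z≤k (ℕₚ.<⇒≤ (ℕₚ.≰⇒> c≰k))))
  Q≋g : ∀ f → Q f ≋ g f
  Q≋g f = subst (λ b → Q f ≋ (if b then K g f else g f))
    (≤ᵇ-false (ℕₚ.≤∧≢⇒< (ℕₚ.≰⇒> c≰k) (c≢ ∘ sym))) (Q≋ f)
... | q | Q≋ | false | ofⁿ z≰k | true | ofʸ c≤k =
  ≋-trans (T-big-small c k cs (moved z) (isPositive z)
            (λ σ → cong (λ b → if b then isNegative (σ ◃ 1) else isPositive z) z≤ᵇk) c≤ᵇk
            (cong (λ b → if b then isNegative c else isPositive z)
              (≤ᵇ-false (ℕₚ.≤-<-trans c≤k (ℕₚ.≰⇒> z≰k)))) ⟦ q ⟧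
            (λ f → subst (λ b → T (moved c) (suc k) cs f ≋ (if b then K ⟦ q ⟧ f else ⟦ q ⟧ f))
              (≤ᵇ-true (ℕₚ.m≤n⇒m≤1+n c≤k)) (Q≋ f)) f)
          (≋-sym (⟦⟧-big-small (t? (isPositive z)) 1+t t q f))
... | q | Q≋ | false | ofⁿ z≰k | false | ofⁿ c≰k = begin
  T (moved z) k (c ∷ cs) f
    ≈⟨ T-big-big c k cs (moved z) (isPositive z)
         (λ σ → cong (λ b → if b then isNegative (σ ◃ 1) else isPositive z) z≤ᵇk) c≤ᵇk f ⟩
  v ⊗ (w ⊗ (J Q f ⊕ J Q f)) ⊕ r ⊗ Q f
    ≈⟨ ⊕-cong (⊗-congˡ v (⊗-congˡ w (⊕-cong (J-cong Q≋g f) (J-cong Q≋g f)))) (⊗-congˡ r (Q≋g f)) ⟩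
  v ⊗ (w ⊗ (J g f ⊕ J g f)) ⊕ r ⊗ g f
    ≈⟨ ⊕-cong (⊗-congˡ v (⊗-congˡ w (⟦⟧-𝕁-double q f))) (⟦⟧-⊡ r q f) ⟨
  v ⊗ (w ⊗ ⟦ 𝕁 (q ⊞ q) ⟧ f) ⊕ ⟦ r ⊡ q ⟧ f
    ≈⟨ ⊕-congʳ _ (⊗-congˡ v (⟦⟧-⊡ w (𝕁 (q ⊞ q)) f)) ⟨
  v ⊗ ⟦ w ⊡ 𝕁 (q ⊞ q) ⟧ f ⊕ ⟦ r ⊡ q ⟧ f
    ≈⟨ ⊕-congʳ _ (⟦⟧-⊡ v (w ⊡ 𝕁 (q ⊞ q)) f) ⟨
  ⟦ v ⊡ w ⊡ 𝕁 (q ⊞ q) ⟧ f ⊕ ⟦ r ⊡ q ⟧ f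
    ≈⟨ ⟦⟧-⊞ (v ⊡ w ⊡ 𝕁 (q ⊞ q)) (r ⊡ q) f ⟨
  ⟦ v ⊡ w ⊡ 𝕁 (q ⊞ q) ⊞ r ⊡ q ⟧ f ∎
  where
  open ≋-Reasoning
  Q g : ℕ → Poly
  Q = T (moved c) (suc k) cs
  g = ⟦ q ⟧
  v = t? (isPositive z)
  w = t? (isNegative c)
  r = t? (isDescent k (moved z) (moved c))
  Q≋g : ∀ f → Q f ≋ g f
  Q≋g f = subst (λ b → Q f ≋ (if b then K g f else g f))
    (≤ᵇ-false (ℕₚ.≤∧≢⇒< (ℕₚ.≰⇒> c≰k) (c≢ ∘ sym))) (Q≋ f)

-- Descents of an inflated word

count-map : {A B : Set} {P : Pred B 0ℓ} (P? : Decidable P) (g : A → B) (xs : List A) →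
  count P? (map g xs) ≡ count (P? ∘ g) xs
count-map P? g []       = refl
count-map P? g (x ∷ xs) with does (P? (g x))
... | true  = cong suc (count-map P? g xs)
... | false = count-map P? g xs

count-cong : {A : Set} {P Q : Pred A 0ℓ} (P? : Decidable P) (Q? : Decidable Q) →
  (∀ x → does (P? x) ≡ does (Q? x)) → ∀ xs → count P? xs ≡ count Q? xs
count-cong P? Q? e []       = refl
count-cong P? Q? e (x ∷ xs) with does (P? x) | does (Q? x) | e x
... | true  | true  | _ = cong suc (count-cong P? Q? e xs)
... | false | false | _ = count-cong P? Q? e xs

𝟙 : Bool → ℕ
𝟙 b = if b then 1 else 0

count-∷ : {A : Set} {P : Pred A 0ℓ} (P? : Decidable P) (x : A) (xs : List A) →
  count P? (x ∷ xs) ≡ 𝟙 (does (P? x)) + count P? xs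
count-∷ P? x xs with does (P? x)
... | true  = refl
... | false = refl

upTo-suc : ∀ n → upTo (suc n) ≡ 0 ∷ map suc (upTo n)
upTo-suc n = cong (0 ∷_) (sym (Listₚ.map-upTo suc n))

des : ∀ {n} → ℤ → Word n → ℕ
des z []      = 0
des z (x ∷ π) = 𝟙 (does (x ℤₚ.<? z)) + des x π

⟨⟩-letter : ∀ {n} (π : Word n) i → π ⟨ + i ⟩ ≡ letter (+ 0 ∷ π) i
⟨⟩-letter π zero    = refl
⟨⟩-letter π (suc i) = refl

desᴮ≡des : ∀ {n} (π : Word n) → desᴮ π ≡ des (+ 0) π
desᴮ≡des {n} π = trans
  (count-cong _ _ (λ i → cong (λ z → does (letter π i ℤₚ.<? z)) (⟨⟩-letter π i)) (upTo n))
  (count-des (+ 0) π)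
  where
  count-des : ∀ {n} z (π : Word n) →
    count (λ i → letter π i ℤₚ.<? letter (z ∷ π) i) (upTo n) ≡ des z π
  count-des z []      = refl
  count-des {suc n} z (x ∷ π) = trans
    (cong (count (λ i → letter (x ∷ π) i ℤₚ.<? letter (z ∷ x ∷ π) i)) (upTo-suc n))
    (trans (count-∷ (λ i → letter (x ∷ π) i ℤₚ.<? letter (z ∷ x ∷ π) i) 0 (map suc (upTo n)))
      (cong (λ d → 𝟙 (does (x ℤₚ.<? z)) + d) (trans (count-map _ suc (upTo n)) (count-des x π))))

-- A way to interleave m moved letters with f signed fixed points.
data Skel : ℕ → ℕ → ℕ → Set where
  done : Skel 0 0 0
  fix  : ∀ {n m f} → Sign → Skel n m f → Skel (suc n) m (suc f)
  move : ∀ {n m f} → Skel n m f → Skel (suc n) (suc m) f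

skels : ∀ n m f → List (Skel n m f)
skels zero    zero    zero    = done ∷ []
skels zero    zero    (suc f) = []
skels zero    (suc m) f       = []
skels (suc n) zero    zero    = []
skels (suc n) zero    (suc f) = map (fix Sign.+) (skels n zero f) ++ map (fix Sign.-) (skels n zero f)
skels (suc n) (suc m) zero    = map move (skels n m zero)
skels (suc n) (suc m) (suc f) =
  (map (fix Sign.+) (skels n (suc m) f) ++ map (fix Sign.-) (skels n (suc m) f)) ++
  map move (skels n m (suc f))

-- place s l is the position of the l-th moved letter. The values at 0 and beyond
-- the last moved letter make place s strictly increasing on all of ℕ.
place : ∀ {n m f} → Skel n m f → ℕ → ℕ
place s         zero    = 0
place done      (suc l) = suc l
place (fix σ s) (suc l) = suc (place s (suc l))
place (move s)  (suc l) = suc (place s l)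

-- The first i letters have already been written.
fill : ∀ {n m f} → ℕ → Skel n m f → Word m → Word n
fill i done      []       = []
fill i (fix σ s) vs       = (σ ◃ suc i) ∷ fill (suc i) s vs
fill i (move s)  (v ∷ vs) = v ∷ fill (suc i) s vs

embed : (ℕ → ℕ) → ℤ → ℤ
embed q (+ l)    = + q l
embed q -[1+ l ] = - + q (suc l)

inflate : ∀ {n m f} → Word m → Skel n m f → Word n
inflate c s = fill 0 s (Vec.map (embed (place s)) c)

StrictlyIncreasing : (ℕ → ℕ) → Set
StrictlyIncreasing q = ∀ {a b} → a < b → q a < q b

place-increasing : ∀ {n m f} (s : Skel n m f) → StrictlyIncreasing (place s)
place-increasing s = from-steps (step s)
  where
  step : ∀ {n m f} (s : Skel n m f) l → place s l < place s (suc l)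
  step done      zero    = s≤s z≤n
  step done      (suc l) = ℕₚ.≤-refl
  step (fix σ s) zero    = s≤s z≤n
  step (fix σ s) (suc l) = s≤s (step s (suc l))
  step (move s)  zero    = s≤s z≤n
  step (move s)  (suc l) = s≤s (step s l)
  from-steps : ∀ {q} → (∀ l → q l < q (suc l)) → StrictlyIncreasing q
  from-steps h {a} {suc b} (s≤s a≤b) with ℕₚ.m≤n⇒m<n∨m≡n a≤b
  ... | inj₁ a<b  = ℕₚ.<-trans (from-steps h a<b) (h b)
  ... | inj₂ refl = h b

descents : ∀ {n m f} → Label → ℕ → Word m → Skel n m f → ℕ
descents ζ k cs       done      = 0
descents ζ k cs       (fix σ s) = 𝟙 (isDescent k ζ (fixed σ)) + descents (fixed σ) k cs s
descents ζ k (c ∷ cs) (move s)  = 𝟙 (isDescent k ζ (moved c)) + descents (moved c) (suc k) cs s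

<?-up : ∀ y z → ∣ z ∣ < ∣ y ∣ → does (y ℤₚ.<? z) ≡ isNegative y
<?-up (+ y)    (+ z)    z<y = dec-false (+ y ℤₚ.<? + z) λ { (+<+ y<z) → ℕₚ.<-asym z<y y<z }
<?-up (+ y)    -[1+ z ] z<y = refl
<?-up -[1+ y ] (+ z)    z<y = refl
<?-up -[1+ y ] -[1+ z ] z<y = dec-true (-[1+ y ] ℤₚ.<? -[1+ z ]) (-<- (ℕₚ.≤-pred z<y))

<?-down : ∀ y z → ∣ y ∣ < ∣ z ∣ → does (y ℤₚ.<? z) ≡ isPositive z
<?-down (+ y)    (+ suc z) y<z = dec-true (+ y ℤₚ.<? + suc z) (+<+ y<z)
<?-down (+ y)    -[1+ z ]  y<z = refl
<?-down -[1+ y ] (+ suc z) y<z = refl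
<?-down -[1+ y ] -[1+ z ]  y<z = dec-false (-[1+ y ] ℤₚ.<? -[1+ z ])
  λ { (-<- z<y) → ℕₚ.<-asym (ℕₚ.≤-pred y<z) z<y }

isNegative-◃ : ∀ σ i → isNegative (σ ◃ suc i) ≡ isNegative (σ ◃ 1)
isNegative-◃ Sign.+ i = refl
isNegative-◃ Sign.- i = refl

isPositive-◃ : ∀ σ i → isPositive (σ ◃ suc i) ≡ isPositive (σ ◃ 1)
isPositive-◃ Sign.+ i = refl
isPositive-◃ Sign.- i = refl

∣embed∣ : ∀ q c → ∣ embed q c ∣ ≡ q ∣ c ∣
∣embed∣ q (+ l)    = refl
∣embed∣ q -[1+ l ] = ℤₚ.∣-i∣≡∣i∣ (+ q (suc l))

-- In a tie of absolute values between neighbouring moved letters `isDescent` would not reflect the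
-- order of the integers.
Apart : ∀ {m} → Label → Word m → Set
Apart ζ         []       = ⊤
Apart (fixed σ) (c ∷ cs) = Apart (moved c) cs
Apart (moved z) (c ∷ cs) = ∣ z ∣ ≢ ∣ c ∣ × Apart (moved c) cs

Apart-fixed : ∀ {m} ζ σ (cs : Word m) → Apart ζ cs → Apart (fixed σ) cs
Apart-fixed ζ         σ []       _       = _
Apart-fixed (fixed _) σ (c ∷ cs) a       = a
Apart-fixed (moved _) σ (c ∷ cs) (_ , a) = a

Apart-moved : ∀ {m} ζ c (cs : Word m) → Apart ζ (c ∷ cs) → Apart (moved c) cs
Apart-moved (fixed _) c cs a       = a
Apart-moved (moved _) c cs (_ , a) = a

module _ (q : ℕ → ℕ) (q-inc : StrictlyIncreasing q) (q0 : q 0 ≡ 0) where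

  isNegative-embed : ∀ c → isNegative (embed q c) ≡ isNegative c
  isNegative-embed (+ l)    = refl
  isNegative-embed -[1+ l ] with q (suc l) | q-inc {0} {suc l} (s≤s z≤n)
  ... | suc _ | _ = refl

  isPositive-embed : ∀ c → isPositive (embed q c) ≡ isPositive c
  isPositive-embed (+ zero)  rewrite q0 = refl
  isPositive-embed (+ suc l) with q (suc l) | q-inc {0} {suc l} (s≤s z≤n)
  ... | suc _ | _ = refl
  isPositive-embed -[1+ l ]  with q (suc l)
  ... | zero  = refl
  ... | suc _ = refl

  -- The letter labelled ζ stands in position i, and k moved letters stand in
  -- positions up to i.
  Labels : ℕ → ℕ → ℤ → Label → Set
  Labels i k z (fixed σ) = z ≡ σ ◃ i × (∀ l → l ≤ k → q l < i)
  Labels i k z (moved c) = z ≡ embed q c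

  module _ {i k} (past : ∀ l → l ≤ k → q l ≤ i) (future : ∀ l → k < l → i < q l) where

    -- The new fixed letter itself takes position `suc i`, so the moved letters still to come lie
    -- strictly beyond it. This is why the bound here is stronger than `future`.
    fixed-descent : ∀ z ζ σ → (∀ l → k < l → suc i < q l) → Labels i k z ζ →
      does (σ ◃ suc i ℤₚ.<? z) ≡ isDescent k ζ (fixed σ)
    fixed-descent z (fixed τ) σ _ (refl , _) = trans
      (<?-up (σ ◃ suc i) z (subst₂ _<_ (sym (ℤₚ.abs-◃ τ i)) (sym (ℤₚ.abs-◃ σ (suc i))) ℕₚ.≤-refl))
      (isNegative-◃ σ i)
    fixed-descent z (moved c) σ future⁺ refl with ∣ c ∣ ≤ᵇ k | ℕₚ.≤ᵇ-reflects-≤ ∣ c ∣ k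
    ... | true  | ofʸ c≤k = trans
      (<?-up (σ ◃ suc i) z (subst₂ _<_ (sym (∣embed∣ q c)) (sym (ℤₚ.abs-◃ σ (suc i))) (s≤s (past _ c≤k))))
      (isNegative-◃ σ i)
    ... | false | ofⁿ c≰k = trans
      (<?-down (σ ◃ suc i) z (subst₂ _<_ (sym (ℤₚ.abs-◃ σ (suc i))) (sym (∣embed∣ q c)) (future⁺ _ (ℕₚ.≰⇒> c≰k))))
      (isPositive-embed c)

    moved-descent : ∀ {m} z ζ c (cs : Word m) → Apart ζ (c ∷ cs) → Labels i k z ζ →
      does (embed q c ℤₚ.<? z) ≡ isDescent k ζ (moved c)
    moved-descent z (fixed τ) c cs _ (refl , past⁻) with ∣ c ∣ ≤ᵇ k | ℕₚ.≤ᵇ-reflects-≤ ∣ c ∣ k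
    ... | false | ofⁿ c≰k = trans
      (<?-up (embed q c) z (subst₂ _<_ (sym (ℤₚ.abs-◃ τ i)) (sym (∣embed∣ q c)) (future _ (ℕₚ.≰⇒> c≰k))))
      (isNegative-embed c)
    ... | true  | ofʸ c≤k = trans
      (<?-down (embed q c) z (subst₂ _<_ (sym (∣embed∣ q c)) (sym (ℤₚ.abs-◃ τ i)) (past⁻ _ c≤k)))
      (isPositive-fixed i (past⁻ _ c≤k))
      where
      isPositive-fixed : ∀ i {a} → a < i → isPositive (τ ◃ i) ≡ isPositive (τ ◃ 1)
      isPositive-fixed (suc i) _ = isPositive-◃ τ i
    moved-descent z (moved b) c cs (b≢c , _) refl with ∣ b ∣ ≤ᵇ ∣ c ∣ | ℕₚ.≤ᵇ-reflects-≤ ∣ b ∣ ∣ c ∣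
    ... | true  | ofʸ b≤c = trans
      (<?-up (embed q c) z (subst₂ _<_ (sym (∣embed∣ q b)) (sym (∣embed∣ q c)) (q-inc (ℕₚ.≤∧≢⇒< b≤c b≢c))))
      (isNegative-embed c)
    ... | false | ofⁿ b≰c = trans
      (<?-down (embed q c) z (subst₂ _<_ (sym (∣embed∣ q c)) (sym (∣embed∣ q b)) (q-inc (ℕₚ.≰⇒> b≰c))))
      (isPositive-embed b)

  q-mono : ∀ {a b} → a ≤ b → q a ≤ q b
  q-mono a≤b with ℕₚ.m≤n⇒m<n∨m≡n a≤b
  ... | inj₁ a<b  = ℕₚ.<⇒≤ (q-inc a<b)
  ... | inj₂ refl = ℕₚ.≤-refl

  -- The map `q` belongs to the whole word and stays the same, while the induction descends into the
  -- rest `s` of the skeleton. The first hypothesis is the invariant that links them: after `i`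
  -- letters, `k` of them moved, `q` is `place s` with its argument shifted by `k` and its value by
  -- `i`.
  des-fill : ∀ {n m f} i k z ζ (cs : Word m) (s : Skel n m f) →
    (∀ l → q (suc k + l) ≡ i + place s (suc l)) → (∀ l → l ≤ k → q l ≤ i) →
    Labels i k z ζ → Apart ζ cs →
    des z (fill i s (Vec.map (embed q) cs)) ≡ descents ζ k cs s
  des-fill i k z ζ [] done _ _ _ _ = refl
  des-fill i k z ζ cs (fix σ s) e past lab apart = cong₂ _+_
    (cong 𝟙 (fixed-descent past (λ l → ℕₚ.<⇒≤ ∘ future l) z ζ σ future lab))
    (des-fill (suc i) k (σ ◃ suc i) (fixed σ) cs s e′ (λ l → ℕₚ.m≤n⇒m≤1+n ∘ past l)
      (refl , λ l → s≤s ∘ past l) (Apart-fixed ζ σ cs apart))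
    where
    e′ : ∀ l → q (suc k + l) ≡ suc i + place s (suc l)
    e′ l = trans (e l) (ℕₚ.+-suc i _)
    future : ∀ l → k < l → suc i < q l
    future l k<l = begin-strict
      suc i                      <⟨ ℕₚ.m<m+n (suc i) (place-increasing s (s≤s z≤n)) ⟩
      suc i + place s 1          ≡⟨ e′ 0 ⟨
      q (suc k + 0)              ≤⟨ q-mono (subst (_≤ l) (sym (ℕₚ.+-identityʳ (suc k))) k<l) ⟩
      q l                        ∎
      where open ℕₚ.≤-Reasoning
  des-fill i k z ζ (c ∷ cs) (move s) e past lab apart = cong₂ _+_
    (cong 𝟙 (moved-descent past future z ζ c cs apart lab))
    (des-fill (suc i) (suc k) (embed q c) (moved c) cs s e′ past′ refl (Apart-moved ζ c cs apart))
    where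
    e′ : ∀ l → q (suc (suc k) + l) ≡ suc i + place s (suc l)
    e′ l = trans (cong q (sym (ℕₚ.+-suc (suc k) l))) (trans (e (suc l)) (ℕₚ.+-suc i _))
    e₀ : q (suc k) ≡ suc i
    e₀ = trans (cong q (sym (ℕₚ.+-identityʳ (suc k)))) (trans (e 0) (ℕₚ.+-comm i 1))
    future : ∀ l → k < l → i < q l
    future l k<l = subst (_≤ q l) e₀ (q-mono k<l)
    past′ : ∀ l → l ≤ suc k → q l ≤ suc i
    past′ l l≤ = subst (q l ≤_) e₀ (q-mono l≤)

t^-+ : ∀ b n → t ^ᵖ (𝟙 b + n) ≋ t? b ⊗ t ^ᵖ n
t^-+ true  n = ≋-refl
t^-+ false n = ≋-sym (⊗-identityˡ (t ^ᵖ n))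

Σᵖ-++ : ∀ ps qs → Σᵖ (ps ++ qs) ≋ Σᵖ ps ⊕ Σᵖ qs
Σᵖ-++ []       qs = ≋-refl
Σᵖ-++ (p ∷ ps) qs = ≋-trans (⊕-congˡ p (Σᵖ-++ ps qs)) (≋-sym (⊕-assoc p (Σᵖ ps) (Σᵖ qs)))

Σᵖ-map-cong : {A : Set} {g h : A → Poly} {xs : List A} → All (λ x → g x ≋ h x) xs →
  Σᵖ (map g xs) ≋ Σᵖ (map h xs)
Σᵖ-map-cong []       = ≋-refl
Σᵖ-map-cong (e ∷ es) = ⊕-cong e (Σᵖ-map-cong es)

Σᵖ-⊗ : {A : Set} (a : Poly) (g : A → Poly) → ∀ xs → Σᵖ (map (λ x → a ⊗ g x) xs) ≋ a ⊗ Σᵖ (map g xs)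
Σᵖ-⊗ a g []       = ≋-sym (⊗-zeroʳ a)
Σᵖ-⊗ a g (x ∷ xs) = ≋-trans (⊕-congˡ (a ⊗ g x) (Σᵖ-⊗ a g xs)) (≋-sym (⊗-distribˡ a (g x) _))

-- The two recursions branch alike. The equation excludes the sizes for which `skels n m f` is empty
-- while `T` is not zero.
Σ-descents : ∀ {n m f} ζ k (cs : Word m) → n ≡ m + f →
  Σᵖ (map (λ s → t ^ᵖ descents ζ k cs s) (skels n m f)) ≋ T ζ k cs f

private
  Σ-fix : ∀ {n m f} ζ k (cs : Word m) σ → n ≡ m + f →
    Σᵖ (map (λ s → t ^ᵖ descents ζ k cs s) (map (fix σ) (skels n m f))) ≋
    t? (isDescent k ζ (fixed σ)) ⊗ T (fixed σ) k cs f
  Σ-fix {n} {m} {f} ζ k cs σ e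
    rewrite sym (Listₚ.map-∘ {g = λ s → t ^ᵖ descents ζ k cs s} {f = fix σ} (skels n m f)) =
    ≋-trans (Σᵖ-map-cong (All.universal (λ s → t^-+ (isDescent k ζ (fixed σ)) (descents (fixed σ) k cs s)) (skels n m f)))
    (≋-trans (Σᵖ-⊗ (t? (isDescent k ζ (fixed σ))) (λ s → t ^ᵖ descents (fixed σ) k cs s) (skels n m f))
      (⊗-congˡ (t? (isDescent k ζ (fixed σ))) (Σ-descents (fixed σ) k cs e)))

  Σ-fixes : ∀ {n m f} ζ k (cs : Word m) → n ≡ m + f →
    Σᵖ (map (λ s → t ^ᵖ descents ζ k cs s) (map (fix Sign.+) (skels n m f) ++ map (fix Sign.-) (skels n m f))) ≋
    t? (isDescent k ζ (fixed Sign.+)) ⊗ T (fixed Sign.+) k cs f ⊕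
    t? (isDescent k ζ (fixed Sign.-)) ⊗ T (fixed Sign.-) k cs f
  Σ-fixes {n} {m} {f} ζ k cs e
    rewrite Listₚ.map-++ (λ s → t ^ᵖ descents ζ k cs s) (map (fix Sign.+) (skels n m f)) (map (fix Sign.-) (skels n m f)) =
    ≋-trans (Σᵖ-++ (map _ (map (fix Sign.+) (skels n m f))) _)
      (⊕-cong (Σ-fix ζ k cs Sign.+ e) (Σ-fix ζ k cs Sign.- e))

  Σ-move : ∀ {n m f} ζ k c (cs : Word m) → n ≡ m + f →
    Σᵖ (map (λ s → t ^ᵖ descents ζ k (c ∷ cs) s) (map move (skels n m f))) ≋
    t? (isDescent k ζ (moved c)) ⊗ T (moved c) (suc k) cs f
  Σ-move {n} {m} {f} ζ k c cs e
    rewrite sym (Listₚ.map-∘ {g = λ s → t ^ᵖ descents ζ k (c ∷ cs) s} {f = move} (skels n m f)) =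
    ≋-trans (Σᵖ-map-cong (All.universal (λ s → t^-+ (isDescent k ζ (moved c)) (descents (moved c) (suc k) cs s)) (skels n m f)))
    (≋-trans (Σᵖ-⊗ (t? (isDescent k ζ (moved c))) (λ s → t ^ᵖ descents (moved c) (suc k) cs s) (skels n m f))
      (⊗-congˡ (t? (isDescent k ζ (moved c))) (Σ-descents (moved c) (suc k) cs e)))

Σ-descents {zero}  {zero}  {zero}  ζ k []       e = ≋-refl
Σ-descents {suc n} {zero}  {suc f} ζ k []       e = Σ-fixes ζ k [] (ℕₚ.suc-injective e)
Σ-descents {suc n} {suc m} {zero}  ζ k (c ∷ cs) e = Σ-move ζ k c cs (ℕₚ.suc-injective e)
Σ-descents {suc n} {suc m} {suc f} ζ k (c ∷ cs) e
  rewrite Listₚ.map-++ (λ s → t ^ᵖ descents ζ k (c ∷ cs) s)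
    (map (fix Sign.+) (skels n (suc m) f) ++ map (fix Sign.-) (skels n (suc m) f)) (map move (skels n m (suc f))) =
  ≋-trans (Σᵖ-++ (map _ (map (fix Sign.+) (skels n (suc m) f) ++ map (fix Sign.-) (skels n (suc m) f))) _)
    (⊕-cong (Σ-fixes ζ k (c ∷ cs) (trans (ℕₚ.suc-injective e) (ℕₚ.+-suc m f)))
            (Σ-move ζ k c cs (ℕₚ.suc-injective e)))

-- Signed involutions

unique⇒↭ : {A : Set} {xs ys : List A} → Unique xs → Unique ys →
  (∀ {x} → x ∈ xs → x ∈ ys) → (∀ {x} → x ∈ ys → x ∈ xs) → xs ↭ ys
unique⇒↭ xs! ys! xs⊆ys ys⊆xs = ∼bag⇒↭ (unique∧set⇒bag xs! ys! (mk⇔ xs⊆ys ys⊆xs))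

unique-map : {A B : Set} (g : A → B) {xs : List A} →
  (∀ {x y} → x ∈ xs → y ∈ xs → g x ≡ g y → x ≡ y) → Unique xs → Unique (map g xs)
unique-map g inj [] = []
unique-map g inj (x∉xs ∷ xs!) =
  Allₚ.map⁺ (All.tabulate λ y∈xs gx≡gy → All.lookup x∉xs y∈xs (inj (here refl) (there y∈xs) gx≡gy)) ∷
  unique-map g (λ x∈ y∈ → inj (there x∈) (there y∈)) xs!

-- Injectivity is asked only for first arguments in `xs`, because `inflate` is injective only on
-- words without fixed points.
unique-cartesianProductWith : {A B D : Set} (g : A → B → D) {xs : List A} {ys : List B} →
  (∀ {x x′ y y′} → x ∈ xs → x′ ∈ xs → g x y ≡ g x′ y′ → x ≡ x′ × y ≡ y′) →
  Unique xs → Unique ys → Unique (cartesianProductWith g xs ys)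
unique-cartesianProductWith g inj [] ys! = []
unique-cartesianProductWith g {x ∷ xs} {ys} inj (x∉xs ∷ xs!) ys! = Uniqueₚ.++⁺
  (unique-map (g x) (λ _ _ → proj₂ ∘ inj (here refl) (here refl)) ys!)
  (unique-cartesianProductWith g (λ x∈ x′∈ → inj (there x∈) (there x′∈)) xs! ys!)
  λ (p , q) → disjoint (∈-map⁻ (g x) p) (∈-cartesianProductWith⁻ g xs ys q)
  where
  disjoint : ∀ {z} → ∃ (λ y → y ∈ ys × z ≡ g x y) →
    ∃₂ (λ x′ y′ → x′ ∈ xs × y′ ∈ ys × z ≡ g x′ y′) → ⊥
  disjoint (_ , _ , e) (_ , _ , x′∈ , _ , e′) =
    All.lookup x∉xs x′∈ (proj₁ (inj (here refl) (there x′∈) (trans (sym e) e′)))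

length≡0⇒∉ : {A : Set} {x : A} {xs : List A} → length xs ≡ 0 → x ∈ xs → ⊥
length≡0⇒∉ {xs = []} _ ()

∈[1⋯]⁺ : ∀ {n a} → 0 < a → a ≤ n → a ∈ [1⋯ n ]
∈[1⋯]⁺ {a = suc a} _ a≤n = ∈-map⁺ suc (∈-upTo⁺ a≤n)

∈[1⋯]⁻ : ∀ {n a} → a ∈ [1⋯ n ] → 0 < a × a ≤ n
∈[1⋯]⁻ p with ∈-map⁻ suc p
... | _ , q , refl = s≤s z≤n , ∈-upTo⁻ q

⟨⟩-neg : ∀ {n} (π : Word n) i → π ⟨ - i ⟩ ≡ - π ⟨ i ⟩
⟨⟩-neg π (+ zero)  = refl
⟨⟩-neg π (+ suc i) = refl
⟨⟩-neg π -[1+ i ]  = sym (ℤₚ.neg-involutive (letter π i))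

∣⟨⟩∣ : ∀ {n} (π : Word n) i → ∣ π ⟨ i ⟩ ∣ ≡ ∣ π ⟨ + ∣ i ∣ ⟩ ∣
∣⟨⟩∣ π (+ i)    = refl
∣⟨⟩∣ π -[1+ i ] = ℤₚ.∣-i∣≡∣i∣ (letter π i)

-- These two conditions already make `π` a signed permutation: an involution is injective, and it
-- sends no positive position to 0 because 0 is sent to 0. The bound keeps letters away from the
-- junk values beyond the end.
record Involutive {n} (π : Word n) : Set where
  field
    bounded    : ∀ a → a ≤ n → ∣ π ⟨ + a ⟩ ∣ ≤ n
    involutive : ∀ a → a ≤ n → π ⟨ π ⟨ + a ⟩ ⟩ ≡ + a

  ∣involutive∣ : ∀ a → a ≤ n → ∣ π ⟨ + ∣ π ⟨ + a ⟩ ∣ ⟩ ∣ ≡ a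
  ∣involutive∣ a a≤n = trans (sym (∣⟨⟩∣ π (π ⟨ + a ⟩))) (cong ∣_∣ (involutive a a≤n))

  positive : ∀ a → a ≤ n → 0 < a → 0 < ∣ π ⟨ + a ⟩ ∣
  positive a a≤n 0<a = ℕₚ.n≢0⇒n>0 λ e →
    ℕₚ.<⇒≢ 0<a (trans (cong (λ i → ∣ π ⟨ + i ⟩ ∣) (sym e)) (∣involutive∣ a a≤n))

open Involutive

map-∣∣-toList : ∀ {n} (π : Word n) → map ∣_∣ (toList π) ≡ map (λ i → ∣ π ⟨ + i ⟩ ∣) [1⋯ n ]
map-∣∣-toList {n} π = begin
  map ∣_∣ (toList π)                    ≡⟨ cong (map ∣_∣) (toList≡ π) ⟩
  map ∣_∣ (map (letter π) (upTo n))     ≡⟨ Listₚ.map-∘ (upTo n) ⟨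
  map (λ i → ∣ letter π i ∣) (upTo n)   ≡⟨ Listₚ.map-∘ (upTo n) ⟩
  map (λ i → ∣ π ⟨ + i ⟩ ∣) [1⋯ n ]     ∎
  where
  open ≡-Reasoning
  toList≡ : ∀ {n} (π : Word n) → toList π ≡ map (letter π) (upTo n)
  toList≡ []              = refl
  toList≡ {suc n} (x ∷ π) = trans (cong (x ∷_) (trans (toList≡ π) (Listₚ.map-∘ (upTo n))))
    (sym (cong (map (letter (x ∷ π))) (upTo-suc n)))

∈ℐᴮ⁻ : ∀ {n} {π : Word n} → π ∈ ℐᴮ n → Involutive π
∈ℐᴮ⁻ {n} {π} π∈ with ∈-filter⁻ isInvolution? {xs = 𝔅 n} π∈
... | π∈𝔅 , inv with ∈-filter⁻ isSignedPermutation? {xs = wordsOver ±[1⋯ n ] n} π∈𝔅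
...   | _ , perm = record
  { bounded = λ where
      zero    _   → z≤n
      (suc a) a<n → proj₂ (∈[1⋯]⁻ (∈-resp-↭ perm
        (subst (∣ letter π a ∣ ∈_) (sym (map-∣∣-toList π))
          (∈-map⁺ (λ i → ∣ π ⟨ + i ⟩ ∣) (∈[1⋯]⁺ (s≤s z≤n) a<n)))))
  ; involutive = λ where
      zero    _   → refl
      (suc a) a<n → All.lookup inv (∣i∣∈⇒i∈± (+ suc a) (∈[1⋯]⁺ (s≤s z≤n) a<n)) }

∈ℐᴮ⁺ : ∀ {n} {π : Word n} → Involutive π → π ∈ ℐᴮ n
∈ℐᴮ⁺ {n} {π} I = ∈-filter⁺ isInvolution? (𝔅-complete perm)
  (Allₚ.++⁺ (Allₚ.map⁺ (All.tabulate λ {a} a∈ → involutive I a (proj₂ (∈[1⋯]⁻ a∈))))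
            (Allₚ.map⁺ (All.tabulate λ {a} a∈ → inv- a (proj₂ (∈[1⋯]⁻ a∈)))))
  where
  inv- : ∀ a → a ≤ n → π ⟨ π ⟨ - + a ⟩ ⟩ ≡ - + a
  inv- a a≤n = trans (cong (π ⟨_⟩) (⟨⟩-neg π (+ a)))
    (trans (⟨⟩-neg π (π ⟨ + a ⟩)) (cong -_ (involutive I a a≤n)))
  σ : ℕ → ℕ
  σ a = ∣ π ⟨ + a ⟩ ∣
  perm : IsSignedPermutation π
  perm = subst (_↭ [1⋯ n ]) (sym (map-∣∣-toList π)) (unique⇒↭
    (unique-map σ (λ {a} {b} a∈ b∈ e → trans (sym (∣involutive∣ I a (proj₂ (∈[1⋯]⁻ a∈))))
      (trans (cong σ e) (∣involutive∣ I b (proj₂ (∈[1⋯]⁻ b∈))))) ([1⋯]-unique n))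
    ([1⋯]-unique n)
    (λ x∈ → into (∈-map⁻ σ x∈))
    (λ {a} a∈ → let 0<a , a≤n = ∈[1⋯]⁻ a∈ in
      subst (_∈ map σ [1⋯ n ]) (∣involutive∣ I a a≤n)
        (∈-map⁺ σ (∈[1⋯]⁺ (positive I a a≤n 0<a) (bounded I a a≤n)))))
    where
    into : ∀ {x} → ∃ (λ a → a ∈ [1⋯ n ] × x ≡ σ a) → x ∈ [1⋯ n ]
    into (a , a∈ , refl) = let 0<a , a≤n = ∈[1⋯]⁻ a∈ in
      ∈[1⋯]⁺ (positive I a a≤n 0<a) (bounded I a a≤n)

ℐᴮ-unique : ∀ n → Unique (ℐᴮ n)
ℐᴮ-unique n = Uniqueₚ.filter⁺ isInvolution? (𝔅-unique n)

-- Fixed and moved letters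

letter-⟨⟩ : ∀ {n} x (π : Word n) {i} → 0 < i → letter (x ∷ π) i ≡ π ⟨ + i ⟩
letter-⟨⟩ x π {suc i} _ = refl

0<place : ∀ {n m f} (s : Skel n m f) l → 0 < place s (suc l)
0<place s l = place-increasing s (s≤s z≤n)

fill-place : ∀ {n m f} i (s : Skel n m f) vs l → fill i s vs ⟨ + place s l ⟩ ≡ vs ⟨ + l ⟩
fill-place i s         vs       zero          = refl
fill-place i done      []       (suc l)       = refl
fill-place i (fix σ s) vs       (suc l)       =
  trans (letter-⟨⟩ (σ ◃ suc i) (fill (suc i) s vs) (0<place s l)) (fill-place (suc i) s vs (suc l))
fill-place i (move s)  (v ∷ vs) (suc zero)    = refl
fill-place i (move s)  (v ∷ vs) (suc (suc l)) =
  trans (letter-⟨⟩ v (fill (suc i) s vs) (0<place s l)) (fill-place (suc i) s vs (suc l))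

place-≤ : ∀ {n m f} (s : Skel n m f) {l} → l ≤ m → place s l ≤ n
place-≤ s         {zero}  _         = z≤n
place-≤ (fix σ s) {suc l} l≤m       = s≤s (place-≤ s l≤m)
place-≤ (move s)  {suc l} (s≤s l≤m) = s≤s (place-≤ s l≤m)

place-≤⁻ : ∀ {n m f} (s : Skel n m f) {l} → place s l ≤ n → l ≤ m
place-≤⁻ s         {zero}  _       = z≤n
place-≤⁻ (fix σ s) {suc l} (s≤s p) = place-≤⁻ s p
place-≤⁻ (move s)  {suc l} (s≤s p) = s≤s (place-≤⁻ s p)

fill-cases : ∀ {n m f} i (s : Skel n m f) vs a → a < n →
  (∃ λ l → l < m × suc a ≡ place s (suc l)) ⊎ (∃ λ σ → letter (fill i s vs) a ≡ σ ◃ suc (i + a))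
fill-cases i (fix σ s) vs zero _ = inj₂ (σ , cong (λ a → σ ◃ suc a) (sym (ℕₚ.+-identityʳ i)))
fill-cases i (fix σ s) vs (suc a) (s≤s a<n) with fill-cases (suc i) s vs a a<n
... | inj₁ (l , l<m , e) = inj₁ (l , l<m , cong suc e)
... | inj₂ (τ , e)       = inj₂ (τ , trans e (cong (λ a → τ ◃ suc a) (sym (ℕₚ.+-suc i a))))
fill-cases i (move s) (v ∷ vs) zero _ = inj₁ (0 , s≤s z≤n , refl)
fill-cases i (move s) (v ∷ vs) (suc a) (s≤s a<n) with fill-cases (suc i) s vs a a<n
... | inj₁ (l , l<m , e) = inj₁ (suc l , s≤s l<m , cong suc e)
... | inj₂ (τ , e)       = inj₂ (τ , trans e (cong (λ a → τ ◃ suc a) (sym (ℕₚ.+-suc i a))))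

Deranged : ∀ {n m f} → ℕ → Skel n m f → Word m → Set
Deranged {m = m} i s vs = ∀ l → l < m → ∣ letter vs l ∣ ≢ i + place s (suc l)

Deranged-fix : ∀ {n m f} i σ (s : Skel n m f) vs → Deranged i (fix σ s) vs → Deranged (suc i) s vs
Deranged-fix i σ s vs h l l<m e = h l l<m (trans e (sym (ℕₚ.+-suc i _)))

Deranged-move : ∀ {n m f} i (s : Skel n m f) {v} vs → Deranged i (move s) (v ∷ vs) → Deranged (suc i) s vs
Deranged-move i s vs h l l<m e = h (suc l) (s≤s l<m) (trans e (sym (ℕₚ.+-suc i _)))

Deranged-head : ∀ {n m f} i (s : Skel n m f) {v} vs → Deranged i (move s) (v ∷ vs) → ∣ v ∣ ≢ suc i
Deranged-head i s vs h e = h 0 (s≤s z≤n) (trans e (ℕₚ.+-comm 1 i))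

fixFrom : ∀ {n} → ℕ → Word n → ℕ
fixFrom i []      = 0
fixFrom i (x ∷ π) = 𝟙 (does (∣ x ∣ ≟ suc i)) + fixFrom (suc i) π

fixᴮ≡fixFrom : ∀ {n} (π : Word n) → fixᴮ π ≡ fixFrom 0 π
fixᴮ≡fixFrom {n} π = trans (count-map (λ i → ∣ π ⟨ + i ⟩ ∣ ≟ i) suc (upTo n)) (count-fix 0 π)
  where
  count-fix : ∀ {n} i (π : Word n) → count (λ a → ∣ letter π a ∣ ≟ suc (i + a)) (upTo n) ≡ fixFrom i π
  count-fix i []              = refl
  count-fix {suc n} i (x ∷ π) = trans
    (cong (count fixed?) (upTo-suc n))
    (trans (count-∷ fixed? 0 (map suc (upTo n))) (cong₂ _+_
      (cong (λ a → 𝟙 (does (∣ x ∣ ≟ suc a))) (ℕₚ.+-identityʳ i))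
      (trans (count-map fixed? suc (upTo n))
      (trans (count-cong (fixed? ∘ suc) (λ a → ∣ letter π a ∣ ≟ suc (suc i + a))
               (λ a → cong (λ b → does (∣ letter π a ∣ ≟ suc b)) (ℕₚ.+-suc i a)) (upTo n))
             (count-fix (suc i) π)))))
    where
    fixed? = λ a → ∣ letter (x ∷ π) a ∣ ≟ suc (i + a)

fixFrom-fill : ∀ {n m f} i (s : Skel n m f) vs → Deranged i s vs → fixFrom i (fill i s vs) ≡ f
fixFrom-fill i done      []       _ = refl
fixFrom-fill i (fix σ s) vs       h = cong₂ _+_
  (cong 𝟙 (dec-true (∣ σ ◃ suc i ∣ ≟ suc i) (ℤₚ.abs-◃ σ (suc i))))
  (fixFrom-fill (suc i) s vs (Deranged-fix i σ s vs h))
fixFrom-fill i (move s)  (v ∷ vs) h = cong₂ _+_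
  (cong 𝟙 (dec-false (∣ v ∣ ≟ suc i) (Deranged-head i s vs h)))
  (fixFrom-fill (suc i) s vs (Deranged-move i s vs h))

dissect : ∀ {n} i (π : Word n) → ∃₂ λ m f → ∃₂ λ (s : Skel n m f) (vs : Word m) →
  π ≡ fill i s vs × Deranged i s vs
dissect i [] = 0 , 0 , done , [] , refl , λ _ ()
dissect i (x ∷ π) with dissect (suc i) π | ∣ x ∣ ≟ suc i
... | m , f , s , vs , e , h | yes x≡ = m , suc f , fix (sign x) s , vs ,
  cong₂ _∷_ (trans (sym (ℤₚ.◃-inverse x)) (cong (sign x ◃_) x≡)) e ,
  λ l l<m e′ → h l l<m (trans e′ (ℕₚ.+-suc i _))
... | m , f , s , vs , e , h | no x≢ = suc m , f , move s , x ∷ vs , cong (x ∷_) e , λ where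
  zero    _         e′ → x≢ (trans e′ (ℕₚ.+-comm i 1))
  (suc l) (s≤s l<m) e′ → h l l<m (trans e′ (ℕₚ.+-suc i _))

Skel-length : ∀ {n m f} → Skel n m f → n ≡ m + f
Skel-length done              = refl
Skel-length (fix {m = m} σ s) = trans (cong suc (Skel-length s)) (sym (ℕₚ.+-suc m _))
Skel-length (move s)          = cong suc (Skel-length s)

-- Derangedness lets the skeleton be read off the word: a position belongs to a fixed point exactly
-- when its letter has that absolute value, and the sign of the letter is the sign in the skeleton.
fill-injectiveˢ : ∀ {n m f} i (s s′ : Skel n m f) vs vs′ → Deranged i s vs → Deranged i s′ vs′ →
  fill i s vs ≡ fill i s′ vs′ → s ≡ s′
fill-injectiveˢ i done      done       vs vs′ h h′ e = refl
fill-injectiveˢ i (fix σ s) (fix τ s′) vs vs′ h h′ e =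
  cong₂ fix (trans (sym (ℤₚ.sign-◃ σ (suc i))) (trans (cong sign (Vecₚ.∷-injectiveˡ e)) (ℤₚ.sign-◃ τ (suc i))))
    (fill-injectiveˢ (suc i) s s′ vs vs′ (Deranged-fix i σ s vs h) (Deranged-fix i τ s′ vs′ h′) (Vecₚ.∷-injectiveʳ e))
fill-injectiveˢ i (fix σ s) (move s′)  vs (v ∷ vs′) h h′ e =
  ⊥-elim (Deranged-head i s′ vs′ h′ (trans (cong ∣_∣ (sym (Vecₚ.∷-injectiveˡ e))) (ℤₚ.abs-◃ σ (suc i))))
fill-injectiveˢ i (move s)  (fix σ s′) (v ∷ vs) vs′ h h′ e =
  ⊥-elim (Deranged-head i s vs h (trans (cong ∣_∣ (Vecₚ.∷-injectiveˡ e)) (ℤₚ.abs-◃ σ (suc i))))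
fill-injectiveˢ i (move s)  (move s′)  (v ∷ vs) (v′ ∷ vs′) h h′ e =
  cong move (fill-injectiveˢ (suc i) s s′ vs vs′ (Deranged-move i s vs h) (Deranged-move i s′ vs′ h′) (Vecₚ.∷-injectiveʳ e))

fill-injectiveᵛ : ∀ {n m f} i (s : Skel n m f) vs vs′ → fill i s vs ≡ fill i s vs′ → vs ≡ vs′
fill-injectiveᵛ i done      []       []         e = refl
fill-injectiveᵛ i (fix σ s) vs       vs′        e = fill-injectiveᵛ (suc i) s vs vs′ (Vecₚ.∷-injectiveʳ e)
fill-injectiveᵛ i (move s)  (v ∷ vs) (v′ ∷ vs′) e =
  cong₂ _∷_ (Vecₚ.∷-injectiveˡ e) (fill-injectiveᵛ (suc i) s vs vs′ (Vecₚ.∷-injectiveʳ e))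

∈-skels : ∀ {n m f} (s : Skel n m f) → s ∈ skels n m f
∈-skels done = here refl
∈-skels (fix {n} {m} {f} σ s) = widen m (either σ)
  where
  fixes : List (Skel (suc n) m (suc f))
  fixes = map (fix Sign.+) (skels n m f) ++ map (fix Sign.-) (skels n m f)
  either : ∀ σ → fix σ s ∈ fixes
  either Sign.+ = ∈-++⁺ˡ (∈-map⁺ (fix Sign.+) (∈-skels s))
  either Sign.- = ∈-++⁺ʳ _ (∈-map⁺ (fix Sign.-) (∈-skels s))
  -- The list `skels` splits on the number of moved letters: with none it consists of the fixed
  -- cases alone, otherwise the moved cases follow them.
  widen : ∀ m′ {x : Skel (suc n) m′ (suc f)} →
    x ∈ map (fix Sign.+) (skels n m′ f) ++ map (fix Sign.-) (skels n m′ f) → x ∈ skels (suc n) m′ (suc f)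
  widen zero     p = p
  widen (suc m′) p = ∈-++⁺ˡ p
∈-skels (move {f = zero}  s) = ∈-map⁺ move (∈-skels s)
∈-skels (move {f = suc f} s) = ∈-++⁺ʳ _ (∈-map⁺ move (∈-skels s))

fix-injective : ∀ {n m f σ τ} {s s′ : Skel n m f} → fix σ s ≡ fix τ s′ → σ ≡ τ × s ≡ s′
fix-injective refl = refl , refl

move-injective : ∀ {n m f} {s s′ : Skel n m f} → move s ≡ move s′ → s ≡ s′
move-injective refl = refl

skels-unique : ∀ n m f → Unique (skels n m f)
fixes-unique : ∀ n m f → Unique (map (fix Sign.+) (skels n m f) ++ map (fix Sign.-) (skels n m f))
fixes-unique n m f = Uniqueₚ.++⁺
  (Uniqueₚ.map⁺ (proj₂ ∘ fix-injective) (skels-unique n m f))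
  (Uniqueₚ.map⁺ (proj₂ ∘ fix-injective) (skels-unique n m f))
  λ (p , q) → disjoint (∈-map⁻ (fix Sign.+) p) (∈-map⁻ (fix Sign.-) q)
  where
  disjoint : ∀ {x} → ∃ (λ s → s ∈ skels n m f × x ≡ fix Sign.+ s) →
    ∃ (λ s → s ∈ skels n m f × x ≡ fix Sign.- s) → ⊥
  disjoint (_ , _ , refl) (_ , _ , ())
skels-unique zero    zero    zero    = [] ∷ []
skels-unique zero    zero    (suc f) = []
skels-unique zero    (suc m) f       = []
skels-unique (suc n) zero    zero    = []
skels-unique (suc n) zero    (suc f) = fixes-unique n zero f
skels-unique (suc n) (suc m) zero    = Uniqueₚ.map⁺ move-injective (skels-unique n m zero)
skels-unique (suc n) (suc m) (suc f) = Uniqueₚ.++⁺ (fixes-unique n (suc m) f)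
  (Uniqueₚ.map⁺ move-injective (skels-unique n m (suc f)))
  λ (p , q) → disjoint (∈-++⁻ (map (fix Sign.+) (skels n (suc m) f)) p) (∈-map⁻ move q)
  where
  disjoint : ∀ {x} → x ∈ map (fix Sign.+) (skels n (suc m) f) ⊎ x ∈ map (fix Sign.-) (skels n (suc m) f) →
    ∃ (λ s → s ∈ skels n m (suc f) × x ≡ move s) → ⊥
  disjoint (inj₁ p) (_ , _ , refl) with ∈-map⁻ (fix Sign.+) p
  ... | _ , _ , ()
  disjoint (inj₂ p) (_ , _ , refl) with ∈-map⁻ (fix Sign.-) p
  ... | _ , _ , ()

-- Inflation as a bijection

module Increasing (q : ℕ → ℕ) (q-inc : StrictlyIncreasing q) where

  q-injective : ∀ {a b} → q a ≡ q b → a ≡ b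
  q-injective {a} {b} e with ℕₚ.<-cmp a b
  ... | tri< a<b _ _ = ⊥-elim (ℕₚ.<⇒≢ (q-inc a<b) e)
  ... | tri≈ _ a≡b _ = a≡b
  ... | tri> _ _ b<a = ⊥-elim (ℕₚ.<⇒≢ (q-inc b<a) (sym e))

  q-reflects : ∀ {a b} → q a < q b → a < b
  q-reflects {a} {b} qa<qb with ℕₚ.<-cmp a b
  ... | tri< a<b _ _  = a<b
  ... | tri≈ _ refl _ = ⊥-elim (ℕₚ.<-irrefl refl qa<qb)
  ... | tri> _ _ b<a  = ⊥-elim (ℕₚ.<-asym qa<qb (q-inc b<a))

  embed-injective : ∀ x y → embed q x ≡ embed q y → x ≡ y
  embed-injective (+ a)    (+ b)    e = cong +_ (q-injective (ℤₚ.+-injective e))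
  embed-injective -[1+ a ] -[1+ b ] e with q-injective (ℤₚ.+-injective (ℤₚ.neg-injective e))
  ... | refl = refl
  embed-injective (+ a)    -[1+ b ] e with q (suc b) | q-inc {0} {suc b} (s≤s z≤n)
  embed-injective (+ a)    -[1+ b ] () | suc _ | _
  embed-injective -[1+ a ] (+ b)    e with q (suc a) | q-inc {0} {suc a} (s≤s z≤n)
  embed-injective -[1+ a ] (+ b)    () | suc _ | _

  map-embed-injective : ∀ {m} (c c′ : Word m) → Vec.map (embed q) c ≡ Vec.map (embed q) c′ → c ≡ c′
  map-embed-injective []      []        e = refl
  map-embed-injective (x ∷ c) (y ∷ c′) e = cong₂ _∷_
    (embed-injective x y (Vecₚ.∷-injectiveˡ e)) (map-embed-injective c c′ (Vecₚ.∷-injectiveʳ e))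

neg-embed : ∀ q → q 0 ≡ 0 → ∀ x → - embed q x ≡ embed q (- x)
neg-embed q q0 (+ zero)  rewrite q0 = refl
neg-embed q q0 (+ suc l) = refl
neg-embed q q0 -[1+ l ]  = ℤₚ.neg-involutive (+ q (suc l))

letter-map : ∀ {m} (g : ℤ → ℤ) → g (+ 0) ≡ + 0 → (c : Word m) → ∀ l → letter (Vec.map g c) l ≡ g (letter c l)
letter-map g g0 []      l       = sym g0
letter-map g g0 (x ∷ c) zero    = refl
letter-map g g0 (x ∷ c) (suc l) = letter-map g g0 c l

map-embed : ∀ {m} q → q 0 ≡ 0 → (c : Word m) → ∀ x → Vec.map (embed q) c ⟨ x ⟩ ≡ embed q (c ⟨ x ⟩)
map-embed q q0 c (+ zero)  = sym (cong +_ q0)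
map-embed q q0 c (+ suc l) = letter-map (embed q) (cong +_ q0) c l
map-embed q q0 c -[1+ l ]  =
  trans (cong -_ (letter-map (embed q) (cong +_ q0) c l)) (neg-embed q q0 (letter c l))

-- On the image of `q` the word `π` acts as `c` does, and every other position is fixed up to sign.
-- The two range conditions match the positions up to `m` with the places up to `n`, since `q` is
-- defined on all of ℕ.
record Conjugate {n m} (q : ℕ → ℕ) (π : Word n) (c : Word m) : Set where
  field
    increasing  : StrictlyIncreasing q
    in-range    : ∀ {l} → l ≤ m → q l ≤ n
    in-range⁻   : ∀ {l} → q l ≤ n → l ≤ m
    q0          : q 0 ≡ 0
    intertwines : ∀ x → π ⟨ embed q x ⟩ ≡ embed q (c ⟨ x ⟩)
    elsewhere   : ∀ a → a ≤ n → (∃ λ l → l ≤ m × a ≡ q l) ⊎ (∃ λ σ → π ⟨ + a ⟩ ≡ σ ◃ a)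

inflate-conjugate : ∀ {n m f} (c : Word m) (s : Skel n m f) → Conjugate (place s) (inflate c s) c
inflate-conjugate {n} {m} c s = record
  { increasing  = place-increasing s
  ; in-range    = place-≤ s
  ; in-range⁻   = place-≤⁻ s
  ; q0          = refl
  ; intertwines = λ x → trans (image x) (map-embed (place s) refl c x)
  ; elsewhere   = cases }
  where
  vs : Word m
  vs = Vec.map (embed (place s)) c
  image : ∀ x → inflate c s ⟨ embed (place s) x ⟩ ≡ vs ⟨ x ⟩
  image (+ l)    = fill-place 0 s vs l
  image -[1+ l ] = trans (⟨⟩-neg (inflate c s) (+ place s (suc l))) (cong -_ (fill-place 0 s vs (suc l)))
  cases : ∀ a → a ≤ n → (∃ λ l → l ≤ m × a ≡ place s l) ⊎ (∃ λ σ → inflate c s ⟨ + a ⟩ ≡ σ ◃ a)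
  cases zero    _   = inj₁ (0 , z≤n , refl)
  cases (suc a) a<n with fill-cases 0 s vs a a<n
  ... | inj₁ (l , l<m , e) = inj₁ (suc l , l<m , e)
  ... | inj₂ p             = inj₂ p

fixed-involutive : ∀ {n} (π : Word n) σ a → π ⟨ + a ⟩ ≡ σ ◃ a → π ⟨ σ ◃ a ⟩ ≡ + a
fixed-involutive π σ      zero    e = refl
fixed-involutive π Sign.+ (suc a) e = e
fixed-involutive π Sign.- (suc a) e = cong -_ e

module _ {n m} {q : ℕ → ℕ} {π : Word n} {c : Word m} (conj : Conjugate q π c) where
  open Conjugate conj
  open Increasing q increasing

  ∣intertwines∣ : ∀ l → ∣ π ⟨ + q l ⟩ ∣ ≡ q ∣ c ⟨ + l ⟩ ∣
  ∣intertwines∣ l = trans (cong ∣_∣ (intertwines (+ l))) (∣embed∣ q (c ⟨ + l ⟩))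

  conjugate-involutive⁺ : Involutive c → Involutive π
  conjugate-involutive⁺ I = record { bounded = bnd ; involutive = inv }
    where
    bnd : ∀ a → a ≤ n → ∣ π ⟨ + a ⟩ ∣ ≤ n
    bnd a a≤n with elsewhere a a≤n
    ... | inj₁ (l , l≤m , refl) = subst (_≤ n) (sym (∣intertwines∣ l)) (in-range (bounded I l l≤m))
    ... | inj₂ (σ , e)          = subst (_≤ n) (sym (trans (cong ∣_∣ e) (ℤₚ.abs-◃ σ a))) a≤n
    inv : ∀ a → a ≤ n → π ⟨ π ⟨ + a ⟩ ⟩ ≡ + a
    inv a a≤n with elsewhere a a≤n
    ... | inj₁ (l , l≤m , refl) = trans (cong (π ⟨_⟩) (intertwines (+ l)))
      (trans (intertwines (c ⟨ + l ⟩)) (cong (embed q) (involutive I l l≤m)))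
    ... | inj₂ (σ , e) = trans (cong (π ⟨_⟩) e) (fixed-involutive π σ a e)

  conjugate-involutive⁻ : Involutive π → Involutive c
  conjugate-involutive⁻ I = record
    { bounded    = λ l l≤m → in-range⁻ (subst (_≤ n) (∣intertwines∣ l) (bounded I (q l) (in-range l≤m)))
    ; involutive = λ l l≤m → embed-injective _ _ (trans (sym (intertwines (c ⟨ + l ⟩)))
        (trans (cong (π ⟨_⟩) (sym (intertwines (+ l)))) (involutive I (q l) (in-range l≤m)))) }

  -- The ends of a two-cycle are distinct, so neither is fixed up to sign and both lie in the image
  -- of `q`. Monotonicity preserves and reflects the order by which each two-cycle is listed once.
  conjugate-cyc₂ : cyc₂ π ≡ cyc₂ c
  conjugate-cyc₂ = trans (↭-length twoCycles↭) (Listₚ.length-map q×q (twoCycles c))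
    where
    pairs : ℕ → List (ℕ × ℕ)
    pairs n = cartesianProduct [1⋯ n ] [1⋯ n ]
    twoCycles : ∀ {n} → Word n → List (ℕ × ℕ)
    twoCycles {n} π = filter (isTwoCycle? π) (pairs n)
    twoCycles-unique : ∀ {n} (π : Word n) → Unique (twoCycles π)
    twoCycles-unique {n} π = Uniqueₚ.filter⁺ (isTwoCycle? π) (Uniqueₚ.cartesianProduct⁺ ([1⋯]-unique n) ([1⋯]-unique n))
    q×q : ℕ × ℕ → ℕ × ℕ
    q×q (a , b) = q a , q b
    ∈-twoCycles⁺ : ∀ {n} (π : Word n) {a b} → 0 < a → a ≤ n → b ≤ n → a < b →
      ∣ π ⟨ + a ⟩ ∣ ≡ b → ∣ π ⟨ + b ⟩ ∣ ≡ a → (a , b) ∈ twoCycles π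
    ∈-twoCycles⁺ π 0<a a≤n b≤n a<b πa πb = ∈-filter⁺ (isTwoCycle? π)
      (∈-cartesianProduct⁺ (∈[1⋯]⁺ 0<a a≤n) (∈[1⋯]⁺ (ℕₚ.<-trans 0<a a<b) b≤n)) (a<b , πa , πb)
    ∈-twoCycles⁻ : ∀ {n} (π : Word n) {a b} → (a , b) ∈ twoCycles π →
      0 < a × a ≤ n × b ≤ n × a < b × ∣ π ⟨ + a ⟩ ∣ ≡ b × ∣ π ⟨ + b ⟩ ∣ ≡ a
    ∈-twoCycles⁻ {n} π p with ∈-filter⁻ (isTwoCycle? π) {xs = pairs n} p
    ... | p∈ , a<b , πa , πb with ∈-cartesianProduct⁻ [1⋯ n ] [1⋯ n ] p∈
    ...   | a∈ , b∈ = proj₁ (∈[1⋯]⁻ a∈) , proj₂ (∈[1⋯]⁻ a∈) , proj₂ (∈[1⋯]⁻ b∈) , a<b , πa , πb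
    moved-place : ∀ {a b} → a ≤ n → ∣ π ⟨ + a ⟩ ∣ ≡ b → a ≢ b → ∃ λ l → l ≤ m × a ≡ q l
    moved-place {a} a≤n πa a≢b with elsewhere a a≤n
    ... | inj₁ p       = p
    ... | inj₂ (σ , e) = ⊥-elim (a≢b (trans (sym (trans (cong ∣_∣ e) (ℤₚ.abs-◃ σ a))) πa))
    into : ∀ {x} → x ∈ twoCycles π → x ∈ map q×q (twoCycles c)
    into x∈ with ∈-twoCycles⁻ π x∈
    ... | 0<a , a≤n , b≤n , a<b , πa , πb
      with moved-place a≤n πa (ℕₚ.<⇒≢ a<b) | moved-place b≤n πb (ℕₚ.<⇒≢ a<b ∘ sym)
    ...   | k , k≤m , refl | l , l≤m , refl = ∈-map⁺ q×q (∈-twoCycles⁺ c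
      (q-reflects (subst (_< q k) (sym q0) 0<a)) k≤m l≤m (q-reflects a<b)
      (q-injective (trans (sym (∣intertwines∣ k)) πa))
      (q-injective (trans (sym (∣intertwines∣ l)) πb)))
    from : ∀ {x} → ∃ (λ y → y ∈ twoCycles c × x ≡ q×q y) → x ∈ twoCycles π
    from ((k , l) , y∈ , refl) with ∈-twoCycles⁻ c y∈
    ... | 0<k , k≤m , l≤m , k<l , ck , cl = ∈-twoCycles⁺ π
      (subst (_< q k) q0 (increasing 0<k)) (in-range k≤m) (in-range l≤m) (increasing k<l)
      (trans (∣intertwines∣ k) (cong q ck)) (trans (∣intertwines∣ l) (cong q cl))
    twoCycles↭ : twoCycles π ↭ map q×q (twoCycles c)
    twoCycles↭ = unique⇒↭ (twoCycles-unique π)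
      (Uniqueₚ.map⁺ (λ e → cong₂ _,_ (q-injective (cong proj₁ e)) (q-injective (cong proj₂ e))) (twoCycles-unique c))
      into (from ∘ ∈-map⁻ q×q)

Γ : ∀ n → ℕ → ℕ → List (Word n)
Γ n j f = filter (λ π → (cyc₂ π ≟ j) ×-dec (fixᴮ π ≟ f)) (ℐᴮ n)

Γ-unique : ∀ n j f → Unique (Γ n j f)
Γ-unique n j f = Uniqueₚ.filter⁺ (λ π → (cyc₂ π ≟ j) ×-dec (fixᴮ π ≟ f)) (ℐᴮ-unique n)

∈Γ⁺ : ∀ {n j f} {π : Word n} → Involutive π → cyc₂ π ≡ j → fixᴮ π ≡ f → π ∈ Γ n j f
∈Γ⁺ {j = j} {f} I e e′ = ∈-filter⁺ (λ π → (cyc₂ π ≟ j) ×-dec (fixᴮ π ≟ f)) (∈ℐᴮ⁺ I) (e , e′)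

∈Γ⁻ : ∀ {n j f} {π : Word n} → π ∈ Γ n j f → Involutive π × cyc₂ π ≡ j × fixᴮ π ≡ f
∈Γ⁻ {n} {j} {f} π∈ with ∈-filter⁻ (λ π → (cyc₂ π ≟ j) ×-dec (fixᴮ π ≟ f)) {xs = ℐᴮ n} π∈
... | π∈ℐ , e , e′ = ∈ℐᴮ⁻ π∈ℐ , e , e′

fixᴮ≡0⁻ : ∀ {m} {c : Word m} → fixᴮ c ≡ 0 → ∀ l → l < m → ∣ letter c l ∣ ≢ suc l
fixᴮ≡0⁻ {c = c} e l l<m cl = length≡0⇒∉ e
  (∈-filter⁺ (λ i → ∣ c ⟨ + i ⟩ ∣ ≟ i) (∈[1⋯]⁺ (s≤s z≤n) l<m) cl)

fixᴮ≡0⁺ : ∀ {m} {c : Word m} → (∀ l → l < m → ∣ letter c l ∣ ≢ suc l) → fixᴮ c ≡ 0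
fixᴮ≡0⁺ {m} {c} h = cong length (Listₚ.filter-none (λ i → ∣ c ⟨ + i ⟩ ∣ ≟ i)
  (Allₚ.map⁺ (All.tabulate λ {l} l∈ → h l (∈-upTo⁻ l∈))))

inflate-deranged : ∀ {n m f} (c : Word m) (s : Skel n m f) → fixᴮ c ≡ 0 →
  Deranged 0 s (Vec.map (embed (place s)) c)
inflate-deranged c s e l l<m e′ = fixᴮ≡0⁻ {c = c} e l l<m (q-injective (trans
  (sym (trans (cong ∣_∣ (letter-map (embed (place s)) refl c l)) (∣embed∣ (place s) (letter c l)))) e′))
  where open Increasing (place s) (place-increasing s)

inflate-injective : ∀ {n m f} {c c′ : Word m} {s s′ : Skel n m f} → fixᴮ c ≡ 0 → fixᴮ c′ ≡ 0 →
  inflate c s ≡ inflate c′ s′ → c ≡ c′ × s ≡ s′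
inflate-injective {c = c} {c′} {s} {s′} h h′ e
  with fill-injectiveˢ 0 s s′ _ _ (inflate-deranged c s h) (inflate-deranged c′ s′ h′) e
... | refl = map-embed-injective c c′ (fill-injectiveᵛ 0 s _ _ e) , refl
  where open Increasing (place s) (place-increasing s)

inflate-∈Γ : ∀ {n m j f} {c : Word m} (s : Skel n m f) → c ∈ Γ m j 0 → inflate c s ∈ Γ n j f
inflate-∈Γ {c = c} s c∈ with ∈Γ⁻ c∈
... | I , cyc , fix0 = ∈Γ⁺ (conjugate-involutive⁺ conj I) (trans (conjugate-cyc₂ conj) cyc)
  (trans (fixᴮ≡fixFrom (inflate c s)) (fixFrom-fill 0 s _ (inflate-deranged c s fix0)))
  where
  conj : Conjugate (place s) (inflate c s) c
  conj = inflate-conjugate c s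

map-preimage : ∀ {m} (g : ℤ → ℤ) (vs : Word m) → (∀ l → l < m → ∃ λ x → letter vs l ≡ g x) →
  ∃ λ c → vs ≡ Vec.map g c
map-preimage g []       h = [] , refl
map-preimage g (v ∷ vs) h with h 0 (s≤s z≤n) | map-preimage g vs (λ l → h (suc l) ∘ s≤s)
... | x , e | c , e′ = x ∷ c , cong₂ _∷_ e e′

embed-preimage : ∀ q → q 0 ≡ 0 → ∀ v l → ∣ v ∣ ≡ q l → ∃ λ x → v ≡ embed q x
embed-preimage q q0 (+ v)    l       e = + l , cong +_ e
embed-preimage q q0 -[1+ v ] zero    e = ⊥-elim (ℕₚ.1+n≢0 (trans e q0))
embed-preimage q q0 -[1+ v ] (suc l) e = -[1+ l ] , cong (λ a → - + a) e

-- The letters in the places of s name places again, since every other position is fixed.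
moved-letters : ∀ {n m f} (s : Skel n m f) vs → Deranged 0 s vs → Involutive (fill 0 s vs) →
  ∀ l → l < m → ∃ λ x → letter vs l ≡ embed (place s) x
moved-letters {n} s vs h I l l<m with ∣ letter vs l ∣ in v≡ | bounded-v
  where
  bounded-v : ∣ letter vs l ∣ ≤ n
  bounded-v = subst (λ v → ∣ v ∣ ≤ n) (fill-place 0 s vs (suc l))
    (bounded I (place s (suc l)) (place-≤ s l<m))
... | zero  | _   = embed-preimage (place s) refl _ 0 v≡
... | suc a | a<n with fill-cases 0 s vs a a<n
...   | inj₁ (k , _ , e) = embed-preimage (place s) refl _ (suc k) (trans v≡ e)
...   | inj₂ (σ , e)     = ⊥-elim (h l l<m (begin
  ∣ letter vs l ∣                                   ≡⟨ v≡ ⟩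
  suc a                                             ≡⟨ ℤₚ.abs-◃ σ (suc a) ⟨
  ∣ σ ◃ suc a ∣                                     ≡⟨ cong ∣_∣ e ⟨
  ∣ π ⟨ + suc a ⟩ ∣                                 ≡⟨ cong (λ b → ∣ π ⟨ + b ⟩ ∣) v≡ ⟨
  ∣ π ⟨ + ∣ letter vs l ∣ ⟩ ∣                       ≡⟨ cong (λ v → ∣ π ⟨ + ∣ v ∣ ⟩ ∣) (fill-place 0 s vs (suc l)) ⟨
  ∣ π ⟨ + ∣ π ⟨ + place s (suc l) ⟩ ∣ ⟩ ∣           ≡⟨ ∣involutive∣ I _ (place-≤ s l<m) ⟩
  place s (suc l)                                   ∎))
  where
  open ≡-Reasoning
  π : Word n
  π = fill 0 s vs

deflate : ∀ {m j f} {π : Word (m + f)} → π ∈ Γ (m + f) j f →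
  ∃₂ λ (c : Word m) (s : Skel (m + f) m f) → c ∈ Γ m j 0 × π ≡ inflate c s
deflate {m} {j} {f} {π} π∈ with ∈Γ⁻ π∈ | dissect 0 π
... | I , cyc , fixf | m′ , f′ , s , vs , refl , h with trans (sym (fixFrom-fill 0 s vs h)) (trans (sym (fixᴮ≡fixFrom π)) fixf)
-- The dissection has `f` fixed letters by the count `fixᴮ`, so the length `m + f` leaves `m` moved
-- ones.
...   | refl with ℕₚ.+-cancelʳ-≡ f m m′ (Skel-length s)
...     | refl with map-preimage (embed (place s)) vs (moved-letters s vs h I)
...       | c , refl = c , s , ∈Γ⁺ (conjugate-involutive⁻ conj I) (trans (sym (conjugate-cyc₂ conj)) cyc)
  (fixᴮ≡0⁺ {c = c} λ l l<m e → h l l<m (trans (cong ∣_∣ (letter-map (embed (place s)) refl c l))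
    (trans (∣embed∣ (place s) (letter c l)) (cong (place s) e)))) , refl
  where
  conj : Conjugate (place s) (inflate c s) c
  conj = inflate-conjugate c s

Γ↭ : ∀ m j f → Γ (m + f) j f ↭ cartesianProductWith inflate (Γ m j 0) (skels (m + f) m f)
Γ↭ m j f = unique⇒↭ (Γ-unique (m + f) j f)
  (unique-cartesianProductWith inflate
    (λ c∈ c′∈ → inflate-injective (proj₂ (proj₂ (∈Γ⁻ c∈))) (proj₂ (proj₂ (∈Γ⁻ c′∈))))
    (Γ-unique m j 0) (skels-unique (m + f) m f))
  (λ π∈ → into (deflate π∈))
  (λ π∈ → from (∈-cartesianProductWith⁻ inflate (Γ m j 0) (skels (m + f) m f) π∈))
  where
  into : ∀ {π} → ∃₂ (λ (c : Word m) (s : Skel (m + f) m f) → c ∈ Γ m j 0 × π ≡ inflate c s) →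
    π ∈ cartesianProductWith inflate (Γ m j 0) (skels (m + f) m f)
  into (c , s , c∈ , refl) = ∈-cartesianProductWith⁺ inflate c∈ (∈-skels s)
  from : ∀ {π} → ∃₂ (λ c s → c ∈ Γ m j 0 × s ∈ skels (m + f) m f × π ≡ inflate c s) → π ∈ Γ (m + f) j f
  from (c , s , c∈ , _ , refl) = inflate-∈Γ s c∈

-- Summation

Σᵖ-↭ : {A : Set} (g : A → Poly) {xs ys : List A} → xs ↭ ys → Σᵖ (map g xs) ≋ Σᵖ (map g ys)
Σᵖ-↭ g ↭.refl          = ≋-refl
Σᵖ-↭ g (↭.prep x p)    = ⊕-congˡ (g x) (Σᵖ-↭ g p)
Σᵖ-↭ g {_ ∷ _ ∷ xs} {_ ∷ _ ∷ ys} (↭.swap x y p) = ≋-trans (⊕-congˡ (g x) (⊕-congˡ (g y) (Σᵖ-↭ g p)))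
  (solve 3 (λ a b c → a :+ (b :+ c) := b :+ (a :+ c)) ≋-refl (g x) (g y) (Σᵖ (map g ys)))
Σᵖ-↭ g (↭.trans p p′)  = ≋-trans (Σᵖ-↭ g p) (Σᵖ-↭ g p′)

Σᵖ-cartesianProductWith : {A B D : Set} (g : D → Poly) (h : A → B → D) (xs : List A) (ys : List B) →
  Σᵖ (map g (cartesianProductWith h xs ys)) ≋ Σᵖ (map (λ x → Σᵖ (map (λ y → g (h x y)) ys)) xs)
Σᵖ-cartesianProductWith g h []       ys = ≋-refl
Σᵖ-cartesianProductWith g h (x ∷ xs) ys
  rewrite Listₚ.map-++ g (map (h x) ys) (cartesianProductWith h xs ys) | Listₚ.map-∘ {g = g} {f = h x} ys =
  ≋-trans (Σᵖ-++ (map g (map (h x) ys)) (map g (cartesianProductWith h xs ys)))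
    (⊕-congˡ (Σᵖ (map g (map (h x) ys))) (Σᵖ-cartesianProductWith g h xs ys))

Apart? : ∀ {m} ζ → Decidable (Apart {m} ζ)
Apart? ζ         []       = yes _
Apart? (fixed σ) (c ∷ cs) = Apart? (moved c) cs
Apart? (moved z) (c ∷ cs) = ¬? (∣ z ∣ ≟ ∣ c ∣) ×-dec Apart? (moved c) cs

Admissible? : ∀ {m} k → Decidable (Admissible {m} k)
Admissible?         k []       = yes _
Admissible? {suc m} k (c ∷ cs) = ¬? (∣ c ∣ ≟ suc k) ×-dec (∣ c ∣ ≤? k + suc m) ×-dec Admissible? (suc k) cs

Σ-inflate : ∀ {m} f (c : Word m) → Apart (moved (+ 0)) c × Admissible 0 c →
  Σᵖ (map (λ s → t ^ᵖ desᴮ (inflate c s)) (skels (m + f) m f)) ≋ K ⟦ T̂ (+ 0) 0 c ⟧ f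
Σ-inflate {m} f c (apart , admissible) = begin
  Σᵖ (map (λ s → t ^ᵖ desᴮ (inflate c s)) (skels (m + f) m f))
    ≈⟨ Σᵖ-map-cong (All.universal (λ s → ≋-reflexive (cong (t ^ᵖ_) (desᴮ-inflate s))) (skels (m + f) m f)) ⟩
  Σᵖ (map (λ s → t ^ᵖ descents (moved (+ 0)) 0 c s) (skels (m + f) m f))
    ≈⟨ Σ-descents (moved (+ 0)) 0 c refl ⟩
  T (moved (+ 0)) 0 c f
    ≈⟨ T≋T̂ (+ 0) 0 c z≤n admissible f ⟩
  K ⟦ T̂ (+ 0) 0 c ⟧ f ∎
  where
  open ≋-Reasoning
  desᴮ-inflate : (s : Skel (m + f) m f) → desᴮ (inflate c s) ≡ descents (moved (+ 0)) 0 c s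
  desᴮ-inflate s = trans (desᴮ≡des (inflate c s))
    (des-fill (place s) (place-increasing s) refl 0 0 (+ 0) (moved (+ 0)) c s
      (λ l → refl) (λ { zero _ → z≤n }) refl apart)

Σ-T̂ : ∀ {m} → List (Word m) → List Poly
Σ-T̂ cs = foldr _⊞_ [] (map (T̂ (+ 0) 0) cs)

K-⟦[]⟧ : ∀ f → K ⟦ [] ⟧ f ≋ []
K-⟦[]⟧ zero    = ⊗-zeroʳ 1+t
K-⟦[]⟧ (suc f) = ≋-trans (⊗-congˡ 1+t (K-⟦[]⟧ f)) (⊗-zeroʳ 1+t)

Σᵖ-K⟦⟧ : ∀ {m} f (cs : List (Word m)) → Σᵖ (map (λ c → K ⟦ T̂ (+ 0) 0 c ⟧ f) cs) ≋ K ⟦ Σ-T̂ cs ⟧ f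
Σᵖ-K⟦⟧ f []       = ≋-sym (K-⟦[]⟧ f)
Σᵖ-K⟦⟧ f (c ∷ cs) = ≋-trans (⊕-congˡ (K ⟦ T̂ (+ 0) 0 c ⟧ f) (Σᵖ-K⟦⟧ f cs))
  (≋-sym (≋-trans (K-cong (⟦⟧-⊞ (T̂ (+ 0) 0 c) (Σ-T̂ cs)) f) (K-⊕ ⟦ T̂ (+ 0) 0 c ⟧ ⟦ Σ-T̂ cs ⟧ f)))

-- The condition on the words in `Γ m j 0` is decidable and does not involve `f`, so for given `m`
-- and `j` it can be checked by evaluation.
Σ-Γ : ∀ m j f → All (λ c → Apart (moved (+ 0)) c × Admissible 0 c) (Γ m j 0) →
  Σᵖ (map (λ π → t ^ᵖ desᴮ π) (Γ (m + f) j f)) ≋ K ⟦ Σ-T̂ (Γ m j 0) ⟧ f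
Σ-Γ m j f ok = begin
  Σᵖ (map (λ π → t ^ᵖ desᴮ π) (Γ (m + f) j f))
    ≈⟨ Σᵖ-↭ (λ π → t ^ᵖ desᴮ π) (Γ↭ m j f) ⟩
  Σᵖ (map (λ π → t ^ᵖ desᴮ π) (cartesianProductWith inflate (Γ m j 0) (skels (m + f) m f)))
    ≈⟨ Σᵖ-cartesianProductWith (λ π → t ^ᵖ desᴮ π) inflate (Γ m j 0) (skels (m + f) m f) ⟩
  Σᵖ (map (λ c → Σᵖ (map (λ s → t ^ᵖ desᴮ (inflate c s)) (skels (m + f) m f))) (Γ m j 0))
    ≈⟨ Σᵖ-map-cong (All.map (λ {c} → Σ-inflate f c) ok) ⟩
  Σᵖ (map (λ c → K ⟦ T̂ (+ 0) 0 c ⟧ f) (Γ m j 0))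
    ≈⟨ Σᵖ-K⟦⟧ f (Γ m j 0) ⟩
  K ⟦ Σ-T̂ (Γ m j 0) ⟧ f ∎
  where open ≋-Reasoning

-- Evaluation leaves trailing zeros in coefficient lists.
trim : Poly → Poly
trim []      = []
trim (a ∷ p) with a | trim p
... | zero | [] = []
... | b    | q  = b ∷ q

trim-≋ : ∀ p → trim p ≋ p
trim-≋ []      = ≋-refl
trim-≋ (a ∷ p) with a | trim p | trim-≋ p
... | zero  | []    | e = ≋-trans (≋-sym 0∷[]) (∷-cong refl e)
... | zero  | _ ∷ _ | e = ∷-cong refl e
... | suc _ | _     | e = ∷-cong refl e

⟦⟧-trim : ∀ q f → ⟦ map trim q ⟧ f ≋ ⟦ q ⟧ f
⟦⟧-trim []      f       = ≋-refl
⟦⟧-trim (a ∷ q) zero    = trim-≋ a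
⟦⟧-trim (a ∷ q) (suc f) = J-cong (⟦⟧-trim q) (suc f)

-- Coefficients of the powers of `J`

0∷[]-⊗ : ∀ p → (0 ∷ []) ⊗ p ≋ []
0∷[]-⊗ p = ⊗-cong 0∷[] (≋-refl {p})

-- The coefficient of x^f in x^j / (1 - (1+t)x)^(j+1).
E : ℕ → ℕ → Poly
E j f = (f C j ∷ []) ⊗ 1+t ^ᵖ (f ∸ j)

-- For `k ≤ f` the exponents are true differences and one factor `1+t` raises the smaller to the
-- larger. For `f < k`, where truncated subtraction could spoil this, the binomial coefficient
-- vanishes.
E-shift : ∀ i k f → i < k →
  1+t ⊗ ((f C k ∷ []) ⊗ 1+t ^ᵖ (f ∸ suc i)) ≋ (f C k ∷ []) ⊗ 1+t ^ᵖ (f ∸ i)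
E-shift i k f i<k with ℕₚ.≤-<-connex k f
... | inj₂ f<k rewrite k>n⇒nCk≡0 f<k = ≋-trans (⊗-congˡ 1+t (0∷[]-⊗ (1+t ^ᵖ (f ∸ suc i))))
  (≋-trans (⊗-zeroʳ 1+t) (≋-sym (0∷[]-⊗ (1+t ^ᵖ (f ∸ i)))))
... | inj₁ k≤f rewrite ℕₚ.+-∸-assoc 1 (ℕₚ.≤-trans i<k k≤f) =
  solve 3 (λ u c p → u :* (c :* p) := c :* (u :* p)) ≋-refl 1+t (f C k ∷ []) (1+t ^ᵖ (f ∸ suc i))

-- Once `E-shift` has brought both summands to the same power of `1+t`, the recursion of `J` is
-- Pascal's rule.
J-E : ∀ j f → J (E j) f ≋ E (suc j) f
J-E j zero    = ≋-sym (0∷[]-⊗ (1 ∷ []))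
J-E j (suc f) = begin
  E j f ⊕ 1+t ⊗ J (E j) f
    ≈⟨ ⊕-congˡ (E j f) (≋-trans (⊗-congˡ 1+t (J-E j f)) (E-shift j (suc j) f ℕₚ.≤-refl)) ⟩
  (f C j ∷ []) ⊗ p ⊕ (f C suc j ∷ []) ⊗ p
    ≈⟨ ⊗-distribʳ p (f C j ∷ []) (f C suc j ∷ []) ⟨
  (f C j + f C suc j ∷ []) ⊗ p
    ≡⟨ cong (λ c → (c ∷ []) ⊗ p) (nCk+nC[k+1]≡[n+1]C[k+1] f j) ⟩
  E (suc j) (suc f) ∎
  where
  open ≋-Reasoning
  p = 1+t ^ᵖ (f ∸ j)

ΣE : ℕ → List Poly → ℕ → Poly
ΣE j []      f = []
ΣE j (a ∷ q) f = a ⊗ E j f ⊕ ΣE (suc j) q f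

J-ΣE : ∀ j q f → J (ΣE j q) f ≋ ΣE (suc j) q f
J-ΣE j []      zero    = ≋-refl
J-ΣE j []      (suc f) = ≋-trans (⊗-congˡ 1+t (J-ΣE j [] f)) (⊗-zeroʳ 1+t)
J-ΣE j (a ∷ q) f = ≋-trans (J-⊕ (λ f → a ⊗ E j f) (ΣE (suc j) q) f)
  (⊕-cong (≋-trans (J-⊗ a (E j) f) (⊗-congˡ a (J-E j f))) (J-ΣE (suc j) q f))

-- On 1, 0, 0, ... the operator `K` gives the powers of `1+t`, that is `E 0`, and each further `J`
-- raises the index of `E` by one.
K⟦⟧≋ΣE : ∀ q f → K ⟦ q ⟧ f ≋ ΣE 0 q f
K⟦⟧≋ΣE []      f       = K-⟦[]⟧ f
K⟦⟧≋ΣE (a ∷ q) zero    = ⊕-cong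
  (solve 2 (λ a u → a := a :* (con 1 :* con 1)) ≋-refl a 1+t)
  (≋-trans (⊗-zeroʳ 1+t) (J-ΣE 0 q 0))
K⟦⟧≋ΣE (a ∷ q) (suc f) = begin
  -- Here `J ⟦ q ⟧ (suc f)` is `K ⟦ q ⟧ f` by unfolding, so the induction hypothesis covers both
  -- summands.
  J ⟦ q ⟧ (suc f) ⊕ 1+t ⊗ K ⟦ a ∷ q ⟧ f
    ≈⟨ ⊕-cong (K⟦⟧≋ΣE q f) (⊗-congˡ 1+t (K⟦⟧≋ΣE (a ∷ q) f)) ⟩
  ΣE 0 q f ⊕ 1+t ⊗ (a ⊗ ((1 ∷ []) ⊗ 1+t ^ᵖ f) ⊕ ΣE 1 q f)
    ≈⟨ solve 5 (λ u a p s s′ → s :+ u :* (a :* (con 1 :* p) :+ s′) :=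
         a :* (con 1 :* (u :* p)) :+ (s :+ u :* s′)) ≋-refl 1+t a (1+t ^ᵖ f) (ΣE 0 q f) (ΣE 1 q f) ⟩
  a ⊗ E 0 (suc f) ⊕ (ΣE 0 q f ⊕ 1+t ⊗ ΣE 1 q f)
    ≈⟨ ⊕-congˡ (a ⊗ E 0 (suc f)) (⊕-congˡ (ΣE 0 q f) (⊗-congˡ 1+t (J-ΣE 0 q f))) ⟨
  a ⊗ E 0 (suc f) ⊕ J (ΣE 0 q) (suc f)
    ≈⟨ ⊕-congˡ (a ⊗ E 0 (suc f)) (J-ΣE 0 q (suc f)) ⟩
  ΣE 0 (a ∷ q) (suc f) ∎
  where open ≋-Reasoning

-- The coefficients of `J`⁰ to `J`⁴ in the sum over the 12 words. Factors `1+t` are left unexpanded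
-- so that they can be absorbed into the `E j f`. At t = 1 the first entry is 12, the number of
-- words.
Γ-4-2 : List Poly
Γ-4-2 =
  (3 ∷ []) ⊗ t ⊗ 1+t ⊗ 1+t ∷
  (6 ∷ []) ⊗ t ⊗ 1+t ⊗ 1+t ⊗ 1+t ⊕ (24 ∷ []) ⊗ t ⊗ t ⊗ 1+t ∷
  (60 ∷ []) ⊗ t ⊗ t ⊗ 1+t ⊗ 1+t ⊕ (48 ∷ []) ⊗ t ⊗ t ⊗ t ∷
  (192 ∷ []) ⊗ t ⊗ t ⊗ t ⊗ 1+t ∷
  (192 ∷ []) ⊗ t ⊗ t ⊗ t ⊗ t ∷ []

-- An evaluation over the 12 words in Γ 4 2 0.
Σ-T̂-4-2 : map trim (Σ-T̂ (Γ 4 2 0)) ≡ map trim Γ-4-2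
Σ-T̂-4-2 = refl

·-const : ∀ a b → (a * b ∷ []) ≋ (a ∷ []) ⊗ (b ∷ [])
·-const a b = ∷-cong (sym (ℕₚ.+-identityʳ (a * b))) ≋-refl

·-linear : ∀ a b c d p → (a * b + c * d) · p ≋ ((a ∷ []) ⊗ (b ∷ []) ⊕ (c ∷ []) ⊗ (d ∷ [])) ⊗ p
·-linear a b c d p = ≋-trans (≋-sym (∷[]-⊗ (a * b + c * d) p))
  (⊗-cong (⊕-cong (·-const a b) (·-const c d)) (≋-refl {p}))

·-scale : ∀ a b p → (a * b) · p ≋ ((a ∷ []) ⊗ (b ∷ [])) ⊗ p
·-scale a b p = ≋-trans (≋-sym (∷[]-⊗ (a * b) p)) (⊗-cong (·-const a b) (≋-refl {p}))

ΣE-Γ-4-2 : ∀ f → ΣE 0 Γ-4-2 f ≋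
    (6 * f + 3) · (t ⊗ 1+t ^ᵖ (f + 2))
    ⊕ (24 * f + 60 * (f C 2)) · (t ^ᵖ 2 ⊗ 1+t ^ᵖ f)
    ⊕ (48 * (f C 2) + 192 * (f C 3)) · (t ^ᵖ 3 ⊗ 1+t ^ᵖ (f ∸ 2))
    ⊕ (192 * (f C 4)) · (t ^ᵖ 4 ⊗ 1+t ^ᵖ (f ∸ 4))
ΣE-Γ-4-2 f = begin
  ΣE 0 Γ-4-2 f
    -- Each `E j f` is given the factors `1+t` that lift its exponent to the one in the statement:
    -- one for `E 1 f` and `E 3 f`, two for the t² part of `E 2 f`, none for its t³ part and for
    -- `E 4 f`.
    ≈⟨ solve 7 (λ t u e₀ e₁ e₂ e₃ e₄ →
         con 3 :* t :* u :* u :* (con 1 :* e₀) :+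
         ((con 6 :* t :* u :* u :* u :+ con 24 :* t :* t :* u) :* e₁ :+
         ((con 60 :* t :* t :* u :* u :+ con 48 :* t :* t :* t) :* e₂ :+
         (con 192 :* t :* t :* t :* u :* e₃ :+
         (con 192 :* t :* t :* t :* t :* e₄ :+ con 0)))) :=
         con 3 :* t :* u :* u :* e₀ :+
         (con 6 :* t :* u :* u :+ con 24 :* t :* t) :* (u :* e₁) :+
         con 60 :* t :* t :* (u :* (u :* e₂)) :+ con 48 :* t :* t :* t :* e₂ :+
         con 192 :* t :* t :* t :* (u :* e₃) :+ con 192 :* t :* t :* t :* t :* e₄)
       ≋-refl t 1+t p₀ (E 1 f) (E 2 f) (E 3 f) (E 4 f) ⟩
  (3 ∷ []) ⊗ t ⊗ 1+t ⊗ 1+t ⊗ p₀ ⊕ a₁ ⊗ (1+t ⊗ E 1 f) ⊕ a₂ ⊗ (1+t ⊗ (1+t ⊗ E 2 f)) ⊕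
  a₂′ ⊗ E 2 f ⊕ a₃ ⊗ (1+t ⊗ E 3 f) ⊕ a₄ ⊗ E 4 f
    ≈⟨ ⊕-congʳ (a₄ ⊗ E 4 f) (⊕-cong (⊕-congʳ (a₂′ ⊗ E 2 f)
         (⊕-cong (⊕-congˡ ((3 ∷ []) ⊗ t ⊗ 1+t ⊗ 1+t ⊗ p₀) (⊗-congˡ a₁ shift₁)) (⊗-congˡ a₂ shift₂)))
         (⊗-congˡ a₃ (E-shift 2 3 f ℕₚ.≤-refl))) ⟩
  (3 ∷ []) ⊗ t ⊗ 1+t ⊗ 1+t ⊗ p₀ ⊕ a₁ ⊗ (c₁ ⊗ p₀) ⊕ a₂ ⊗ (c₂ ⊗ p₀) ⊕
  a₂′ ⊗ E 2 f ⊕ a₃ ⊗ (c₃ ⊗ p₂) ⊕ a₄ ⊗ E 4 f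
    ≈⟨ solve 8 (λ t p₀ p₂ p₄ c₁ c₂ c₃ c₄ → let u = con 1 :+ t in
         con 3 :* t :* u :* u :* p₀ :+ (con 6 :* t :* u :* u :+ con 24 :* t :* t) :* (c₁ :* p₀) :+
         con 60 :* t :* t :* (c₂ :* p₀) :+ con 48 :* t :* t :* t :* (c₂ :* p₂) :+
         con 192 :* t :* t :* t :* (c₃ :* p₂) :+ con 192 :* t :* t :* t :* t :* (c₄ :* p₄) :=
         (con 6 :* c₁ :+ con 3 :* con 1) :* (t :* (u :* (u :* p₀))) :+
         (con 24 :* c₁ :+ con 60 :* c₂) :* (t :* (t :* con 1) :* p₀) :+
         (con 48 :* c₂ :+ con 192 :* c₃) :* (t :* (t :* (t :* con 1)) :* p₂) :+
         con 192 :* c₄ :* (t :* (t :* (t :* (t :* con 1))) :* p₄))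
       ≋-refl t p₀ p₂ (1+t ^ᵖ (f ∸ 4)) c₁ c₂ c₃ (f C 4 ∷ []) ⟩
  ((6 ∷ []) ⊗ c₁ ⊕ (3 ∷ []) ⊗ (1 ∷ [])) ⊗ (t ⊗ 1+t ^ᵖ (2 + f)) ⊕
  ((24 ∷ []) ⊗ c₁ ⊕ (60 ∷ []) ⊗ c₂) ⊗ (t ^ᵖ 2 ⊗ p₀) ⊕
  ((48 ∷ []) ⊗ c₂ ⊕ (192 ∷ []) ⊗ c₃) ⊗ (t ^ᵖ 3 ⊗ p₂) ⊕
  ((192 ∷ []) ⊗ (f C 4 ∷ [])) ⊗ (t ^ᵖ 4 ⊗ 1+t ^ᵖ (f ∸ 4))
    ≈⟨ ⊕-cong (⊕-cong (⊕-cong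
         (·-linear 6 f 3 1 (t ⊗ 1+t ^ᵖ (2 + f)))
         (·-linear 24 f 60 (f C 2) (t ^ᵖ 2 ⊗ p₀)))
         (·-linear 48 (f C 2) 192 (f C 3) (t ^ᵖ 3 ⊗ p₂)))
         (·-scale 192 (f C 4) (t ^ᵖ 4 ⊗ 1+t ^ᵖ (f ∸ 4))) ⟨
  (6 * f + 3) · (t ⊗ 1+t ^ᵖ (2 + f)) ⊕ (24 * f + 60 * (f C 2)) · (t ^ᵖ 2 ⊗ p₀) ⊕
  (48 * (f C 2) + 192 * (f C 3)) · (t ^ᵖ 3 ⊗ p₂) ⊕ (192 * (f C 4)) · (t ^ᵖ 4 ⊗ 1+t ^ᵖ (f ∸ 4))
    ≡⟨ cong (λ e → (6 * f + 3) · (t ⊗ 1+t ^ᵖ e) ⊕ (24 * f + 60 * (f C 2)) · (t ^ᵖ 2 ⊗ p₀) ⊕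
         (48 * (f C 2) + 192 * (f C 3)) · (t ^ᵖ 3 ⊗ p₂) ⊕ (192 * (f C 4)) · (t ^ᵖ 4 ⊗ 1+t ^ᵖ (f ∸ 4)))
         (ℕₚ.+-comm 2 f) ⟩
  (6 * f + 3) · (t ⊗ 1+t ^ᵖ (f + 2)) ⊕ (24 * f + 60 * (f C 2)) · (t ^ᵖ 2 ⊗ p₀) ⊕
  (48 * (f C 2) + 192 * (f C 3)) · (t ^ᵖ 3 ⊗ p₂) ⊕ (192 * (f C 4)) · (t ^ᵖ 4 ⊗ 1+t ^ᵖ (f ∸ 4)) ∎
  where
  open ≋-Reasoning
  p₀ p₂ c₁ c₂ c₃ a₁ a₂ a₂′ a₃ a₄ : Poly
  p₀ = 1+t ^ᵖ f
  p₂ = 1+t ^ᵖ (f ∸ 2)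
  c₁ = f ∷ []
  c₂ = f C 2 ∷ []
  c₃ = f C 3 ∷ []
  a₁ = (6 ∷ []) ⊗ t ⊗ 1+t ⊗ 1+t ⊕ (24 ∷ []) ⊗ t ⊗ t
  a₂ = (60 ∷ []) ⊗ t ⊗ t
  a₂′ = (48 ∷ []) ⊗ t ⊗ t ⊗ t
  a₃ = (192 ∷ []) ⊗ t ⊗ t ⊗ t
  a₄ = (192 ∷ []) ⊗ t ⊗ t ⊗ t ⊗ t
  shift₁ : 1+t ⊗ E 1 f ≋ c₁ ⊗ p₀
  shift₁ = subst (λ c → 1+t ⊗ E 1 f ≋ (c ∷ []) ⊗ p₀) (nC1≡n f) (E-shift 0 1 f ℕₚ.≤-refl)
  shift₂ : 1+t ⊗ (1+t ⊗ E 2 f) ≋ c₂ ⊗ p₀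
  shift₂ = ≋-trans (⊗-congˡ 1+t (E-shift 1 2 f ℕₚ.≤-refl)) (E-shift 0 2 f (s≤s z≤n))

corollary6p5 : (f : ℕ) → F 2 f ≈
    (6 * f + 3) · (t ⊗ 1+t ^ᵖ (f + 2))
    ⊕ (24 * f + 60 * (f C 2)) · (t ^ᵖ 2 ⊗ 1+t ^ᵖ f)
    ⊕ (48 * (f C 2) + 192 * (f C 3)) · (t ^ᵖ 3 ⊗ 1+t ^ᵖ (f ∸ 2))
    ⊕ (192 * (f C 4)) · (t ^ᵖ 4 ⊗ 1+t ^ᵖ (f ∸ 4))
corollary6p5 f = coeffs (≋-trans F≋ΣE (ΣE-Γ-4-2 f))
  where
  open ≋-Reasoning
  F≋ΣE : F 2 f ≋ ΣE 0 Γ-4-2 f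
  F≋ΣE = begin
    F 2 f
      ≈⟨ Σ-Γ 4 2 f (from-yes (all? (λ c → Apart? (moved (+ 0)) c ×-dec Admissible? 0 c) (Γ 4 2 0))) ⟩
    K ⟦ Σ-T̂ (Γ 4 2 0) ⟧ f
      ≈⟨ K-cong (λ f → ≋-trans (≋-sym (⟦⟧-trim (Σ-T̂ (Γ 4 2 0)) f))
           (≋-trans (≋-reflexive (cong (λ q → ⟦ q ⟧ f) Σ-T̂-4-2)) (⟦⟧-trim Γ-4-2 f))) f ⟩
    K ⟦ Γ-4-2 ⟧ f
      ≈⟨ K⟦⟧≋ΣE Γ-4-2 f ⟩
    ΣE 0 Γ-4-2 f ∎
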